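{- Let $m\ge1$, let $p_1,\dots,p_m\ge 0$ with $p_1+\cdots+p_m=1$, and let $S$ be a finite nonempty word on $[m]=\{1,\dots,m\}$ all of whose letters have positive probability. Roll a die showing face $i$ with probability $p_i$ independently until $S$ first appears as a block of consecutive outcomes, and let $Y$ be the number of rolls. Then for every integer $n\ge 1$, \[ E(Y^n) = \sum_{\pi\in\Pi_n} |\pi|! \prod_{B\in \pi} \sum_{R\in\operatorname{overlap}(S)} \frac{(1-|R|)^{|B|} - (-|R|)^{|B|}}{P(R)}. \]
   Context: For a word $w=w_1\cdots w_\ell$, $|w|=\ell$ and $P(w)=p_{w_1}\cdots p_{w_\ell}$. An overlap of $S$ is a nonempty word that is both a prefix and a suffix of $S$ (including $S$ itself); $\operatorname{overlap}(S)$ is the set of overlaps. $\Pi_n$ is the set of set partitions of $\{1,\dots,n\}$; $|\pi|$ is the number of blocks of $\pi$ and $|B|$ the size of block $B$. Convention $0^0=1$. -}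

module Defs where

open import Data.Empty using (⊥-elim)
open import Data.Fin.Base using (Fin; zero; suc)
open import Data.Fin.Properties using () renaming (_≟_ to _≟ᶠ_)
open import Data.Fin.Subset using (Subset; inside; outside; Nonempty) renaming (_∈_ to _∈ˢ_; ⊥ to ∅)
import Data.Fin.Subset.Properties as Subset
open import Data.Integer.Base as ℤ using (ℤ; +_)
open import Data.List.Base using (List; []; _∷_; map; length; foldr; filter; inits; take; applyUpTo; allFin; cartesianProductWith; concatMap)
open import Data.List.Membership.Propositional using (_∈_; mapWith∈; find)
open import Data.List.Membership.Propositional.Properties using (∈-cartesianProductWith⁺; ∈-cartesianProductWith⁻; ∈-allFin; ∈-filter⁺; ∈-filter⁻; ∈-map⁺; ∈-map⁻; ∈-concatMap⁺; ∈-concatMap⁻; ∈-∃++)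
open import Data.List.Properties using (∷-injective; ∷-injectiveʳ; ≡-dec; map-∘; map-id; filter-all; filter-accept; filter-reject)
open import Data.List.Relation.Binary.Infix.Heterogeneous using (Infix)
open import Data.List.Relation.Binary.Infix.Heterogeneous.Properties using (infix?)
open import Data.List.Relation.Binary.Permutation.Propositional as ↭ using (_↭_; prep; swap; ↭-refl; ↭-reflexive; ↭-sym; ↭-trans)
import Data.List.Relation.Binary.Permutation.Propositional.Properties as ↭
open import Data.List.Relation.Binary.Prefix.Heterogeneous using (Prefix; []; _∷_)
open import Data.List.Relation.Binary.Prefix.Heterogeneous.Properties using (prefix?)
open import Data.List.Relation.Binary.Suffix.Heterogeneous using (Suffix)
open import Data.List.Relation.Binary.Suffix.Heterogeneous.Properties using (suffix?)
open import Data.List.Relation.Unary.All as All using (All; []; _∷_)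
import Data.List.Relation.Unary.All.Properties as All
open import Data.List.Relation.Unary.AllPairs as AllPairs using (AllPairs; []; _∷_)
import Data.List.Relation.Unary.AllPairs.Properties as AllPairs
open import Data.List.Relation.Unary.Any as Any using (Any; here; there)
import Data.List.Relation.Unary.Any.Properties as Any
open import Data.List.Relation.Unary.Unique.Propositional using (Unique)
import Data.List.Relation.Unary.Unique.Propositional.Properties as Unique
open import Data.Nat.Base as ℕ using (ℕ; zero; suc; z≤n; s≤s)
import Data.Nat.Properties as ℕ
open import Data.Product.Base using (∃; _×_; _,_; proj₁; proj₂)
open import Data.Rational.Base as ℚ using (ℚ; 0ℚ; 1ℚ; ½)
import Data.Rational.Properties as ℚ
import Data.Rational.Solver as ℚ
open import Data.Sum.Base using (_⊎_; inj₁; inj₂)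
open import Data.Vec.Base as Vec using ([]; _∷_; here; there)
open import Function.Base using (_∘_)
open import Function.Bundles using (_⇔_; mk⇔; module Equivalence)
open import Relation.Binary.Definitions using (tri<; tri≈; tri>)
open import Relation.Binary.PropositionalEquality using (_≡_; _≢_; refl; sym; trans; cong; cong₂; subst; subst₂)
open import Relation.Nullary using (¬_; yes; no)
open import Relation.Nullary.Decidable using (¬?; _×-dec_)
open import Relation.Unary using (Pred; Decidable)

------------------------------------------------------------------------
-- Real numbers: Cauchy sequences of rationals, up to _≃_.

Eventually : (ℕ → Set) → Set
Eventually P = ∃ λ N → ∀ i → N ℕ.≤ i → P i

record ℝ : Set where
  constructor mkℝ
  field
    seq    : ℕ → ℚ
    cauchy : ∀ ε → 0ℚ ℚ.< ε →
             ∃ λ N → ∀ i j → N ℕ.≤ i → N ℕ.≤ j → ℚ.∣ seq i ℚ.- seq j ∣ ℚ.< ε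
open ℝ public

infix 4 _≃_ _≤ℝ_ _<ℝ_

_≃_ : ℝ → ℝ → Set
x ≃ y = ∀ ε → 0ℚ ℚ.< ε → Eventually λ i → ℚ.∣ seq x i ℚ.- seq y i ∣ ℚ.< ε

_≤ℝ_ : ℝ → ℝ → Set
x ≤ℝ y = ∀ ε → 0ℚ ℚ.< ε → Eventually λ i → seq x i ℚ.< seq y i ℚ.+ ε

_<ℝ_ : ℝ → ℝ → Set
x <ℝ y = ∃ λ ε → 0ℚ ℚ.< ε × Eventually λ i → seq x i ℚ.+ ε ℚ.≤ seq y i

private
  module S = ℚ.+-*-Solver
  open S using (solve; _:=_; _:+_; _:*_; _:-_; con)

  ½-pos : ∀ {ε} → 0ℚ ℚ.< ε → 0ℚ ℚ.< ½ ℚ.* ε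
  ½-pos {ε} ε>0 = subst (ℚ._< ½ ℚ.* ε) (ℚ.*-zeroʳ ½) (ℚ.*-monoʳ-<-pos ½ ε>0)

  ½+½ : ∀ ε → ½ ℚ.* ε ℚ.+ ½ ℚ.* ε ≡ ε
  ½+½ ε = trans (sym (ℚ.*-distribʳ-+ ε ½ ½)) (ℚ.*-identityˡ ε)

  *-pos : ∀ {a b} → 0ℚ ℚ.< a → 0ℚ ℚ.< b → 0ℚ ℚ.< a ℚ.* b
  *-pos {a} {b} a>0 b>0 =
    subst (ℚ._< a ℚ.* b) (ℚ.*-zeroʳ a) (ℚ.*-monoʳ-<-pos a {{ℚ.positive a>0}} b>0)

  swap-dist : ∀ a b → ℚ.∣ a ℚ.- b ∣ ≡ ℚ.∣ b ℚ.- a ∣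
  swap-dist a b = trans (sym (ℚ.∣-p∣≡∣p∣ (a ℚ.- b)))
    (cong ℚ.∣_∣ (solve 2 (λ a b → S.:- (a :- b) := b :- a) refl a b))

  ∣∣≤ : ∀ {t u} → t ℚ.≤ u → ℚ.- t ℚ.≤ u → ℚ.∣ t ∣ ℚ.≤ u
  ∣∣≤ {t} t≤u -t≤u with ℚ.∣p∣≡p∨∣p∣≡-p t
  ... | inj₁ eq = subst (ℚ._≤ _) (sym eq) t≤u
  ... | inj₂ eq = subst (ℚ._≤ _) (sym eq) -t≤u

  ∣∣-sub : ∀ a b → ℚ.∣ a ∣ ℚ.- ℚ.∣ b ∣ ℚ.≤ ℚ.∣ a ℚ.- b ∣
  ∣∣-sub a b = subst₂ ℚ._≤_
    (cong (λ t → ℚ.∣ t ∣ ℚ.- ℚ.∣ b ∣) (solve 2 (λ a b → (a :- b) :+ b := a) refl a b))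
    (solve 2 (λ u v → (u :+ v) :- v := u) refl ℚ.∣ a ℚ.- b ∣ ℚ.∣ b ∣)
    (ℚ.+-monoˡ-≤ (ℚ.- ℚ.∣ b ∣) (ℚ.∣p+q∣≤∣p∣+∣q∣ (a ℚ.- b) b))

  ∣∣-dist : ∀ a b → ℚ.∣ ℚ.∣ a ∣ ℚ.- ℚ.∣ b ∣ ∣ ℚ.≤ ℚ.∣ a ℚ.- b ∣
  ∣∣-dist a b = ∣∣≤ (∣∣-sub a b)
    (subst₂ ℚ._≤_ (solve 2 (λ u v → v :- u := S.:- (u :- v)) refl ℚ.∣ a ∣ ℚ.∣ b ∣)
                  (swap-dist b a) (∣∣-sub b a))

  +-dist : ∀ a b c d →
           ℚ.∣ (a ℚ.+ b) ℚ.- (c ℚ.+ d) ∣ ℚ.≤ ℚ.∣ a ℚ.- c ∣ ℚ.+ ℚ.∣ b ℚ.- d ∣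
  +-dist a b c d = subst (λ t → ℚ.∣ t ∣ ℚ.≤ ℚ.∣ a ℚ.- c ∣ ℚ.+ ℚ.∣ b ℚ.- d ∣)
    (solve 4 (λ a b c d → (a :- c) :+ (b :- d) := (a :+ b) :- (c :+ d)) refl a b c d)
    (ℚ.∣p+q∣≤∣p∣+∣q∣ (a ℚ.- c) (b ℚ.- d))

  *-dist : ∀ a b c d →
           ℚ.∣ a ℚ.* b ℚ.- c ℚ.* d ∣ ℚ.≤ ℚ.∣ a ℚ.* (b ℚ.- d) ∣ ℚ.+ ℚ.∣ d ℚ.* (a ℚ.- c) ∣
  *-dist a b c d = subst (λ t → ℚ.∣ t ∣ ℚ.≤ ℚ.∣ a ℚ.* (b ℚ.- d) ∣ ℚ.+ ℚ.∣ d ℚ.* (a ℚ.- c) ∣)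
    (solve 4 (λ a b c d → a :* (b :- d) :+ d :* (a :- c) := a :* b :- c :* d) refl a b c d)
    (ℚ.∣p+q∣≤∣p∣+∣q∣ (a ℚ.* (b ℚ.- d)) (d ℚ.* (a ℚ.- c)))

fromℚ : ℚ → ℝ
fromℚ q = mkℝ (λ _ → q) λ ε ε>0 → 0 , λ _ _ _ _ →
  subst (ℚ._< ε) (sym (cong ℚ.∣_∣ (ℚ.+-inverseʳ q))) ε>0

fromℤ : ℤ → ℝ
fromℤ z = fromℚ (z ℚ./ 1)

fromℕ : ℕ → ℝ
fromℕ n = fromℤ (+ n)

0ℝ 1ℝ : ℝ
0ℝ = fromℚ 0ℚ
1ℝ = fromℚ 1ℚ

infixl 6 _+ℝ_ _-ℝ_
infixl 7 _*ℝ_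
infix  8 -ℝ_

_+ℝ_ : ℝ → ℝ → ℝ
x +ℝ y = mkℝ (λ i → seq x i ℚ.+ seq y i) λ ε ε>0 →
  let N , hx = cauchy x (½ ℚ.* ε) (½-pos ε>0)
      M , hy = cauchy y (½ ℚ.* ε) (½-pos ε>0)
  in N ℕ.⊔ M , λ i j N≤i N≤j → ℚ.≤-<-trans
       (+-dist (seq x i) (seq y i) (seq x j) (seq y j))
       (subst (_ ℚ.<_) (½+½ ε) (ℚ.+-mono-<
         (hx i j (ℕ.m⊔n≤o⇒m≤o N M N≤i) (ℕ.m⊔n≤o⇒m≤o N M N≤j))
         (hy i j (ℕ.m⊔n≤o⇒n≤o N M N≤i) (ℕ.m⊔n≤o⇒n≤o N M N≤j))))

-ℝ_ : ℝ → ℝ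
-ℝ x = mkℝ (λ i → ℚ.- seq x i) λ ε ε>0 →
  let N , h = cauchy x ε ε>0
  in N , λ i j N≤i N≤j → subst (ℚ._< ε)
       (trans (swap-dist (seq x i) (seq x j)) (cong ℚ.∣_∣
         (solve 2 (λ a b → b :- a := (S.:- a) :- (S.:- b)) refl (seq x i) (seq x j))))
       (h i j N≤i N≤j)

_-ℝ_ : ℝ → ℝ → ℝ
x -ℝ y = x +ℝ (-ℝ y)

∣_∣ℝ : ℝ → ℝ
∣ x ∣ℝ = mkℝ (λ i → ℚ.∣ seq x i ∣) λ ε ε>0 →
  let N , h = cauchy x ε ε>0
  in N , λ i j N≤i N≤j → ℚ.≤-<-trans (∣∣-dist (seq x i) (seq x j)) (h i j N≤i N≤j)

private
  bounded : ∀ x → ∃ λ B → 0ℚ ℚ.< B × Eventually λ i → ℚ.∣ seq x i ∣ ℚ.≤ B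
  bounded x =
    let N , h = cauchy x 1ℚ (ℚ.positive⁻¹ 1ℚ)
        b = ℚ.∣ seq x N ∣
    in 1ℚ ℚ.+ b
     , ℚ.<-≤-trans (ℚ.positive⁻¹ 1ℚ)
         (subst (ℚ._≤ 1ℚ ℚ.+ b) (ℚ.+-identityʳ 1ℚ) (ℚ.+-monoʳ-≤ 1ℚ (ℚ.0≤∣p∣ (seq x N))))
     , N
     , λ i N≤i → subst (ℚ._≤ 1ℚ ℚ.+ b)
         (solve 2 (λ u v → (u :- v) :+ v := u) refl ℚ.∣ seq x i ∣ b)
         (ℚ.+-monoˡ-≤ b (ℚ.≤-trans (∣∣-sub (seq x i) (seq x N))
                                   (ℚ.<⇒≤ (h i N N≤i ℕ.≤-refl))))

  shrink : ∀ {B ε} → 0ℚ ℚ.< B → 0ℚ ℚ.< ε → ∃ λ δ → 0ℚ ℚ.< δ × B ℚ.* δ ≡ ½ ℚ.* ε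
  shrink {B} {ε} B>0 ε>0 = B⁻¹ ℚ.* (½ ℚ.* ε)
    , *-pos (ℚ.positive⁻¹ B⁻¹ {{ℚ.1/pos⇒pos B}}) (½-pos ε>0)
    , trans (sym (ℚ.*-assoc B B⁻¹ (½ ℚ.* ε)))
        (trans (cong (ℚ._* (½ ℚ.* ε)) (ℚ.*-inverseʳ B)) (ℚ.*-identityˡ (½ ℚ.* ε)))
    where
      instance
        B⁺ : ℚ.Positive B
        B⁺ = ℚ.positive B>0
        B≠0 : ℚ.NonZero B
        B≠0 = ℚ.pos⇒nonZero B
      B⁻¹ = ℚ.1/ B

  *-small : ∀ {B δ} a b → 0ℚ ℚ.< B → ℚ.∣ a ∣ ℚ.≤ B → ℚ.∣ b ∣ ℚ.< δ →
            ℚ.∣ a ℚ.* b ∣ ℚ.< B ℚ.* δ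
  *-small {B} {δ} a b B>0 a≤B b<δ = ℚ.≤-<-trans
    (subst (ℚ._≤ B ℚ.* ℚ.∣ b ∣) (sym (ℚ.∣p*q∣≡∣p∣*∣q∣ a b))
      (ℚ.*-monoʳ-≤-nonNeg ℚ.∣ b ∣ {{ℚ.∣-∣-nonNeg b}} a≤B))
    (ℚ.*-monoʳ-<-pos B {{ℚ.positive B>0}} b<δ)

_*ℝ_ : ℝ → ℝ → ℝ
x *ℝ y = mkℝ (λ i → seq x i ℚ.* seq y i) λ ε ε>0 →
  let B , B>0 , K , hB = bounded x
      C , C>0 , L , hC = bounded y
      δ , δ>0 , Bδ = shrink B>0 ε>0
      η , η>0 , Cη = shrink C>0 ε>0
      N , hx = cauchy x η η>0
      M , hy = cauchy y δ δ>0
  in (K ℕ.⊔ L) ℕ.⊔ (N ℕ.⊔ M) , λ i j ≤i ≤j →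
     let K≤i = ℕ.m⊔n≤o⇒m≤o K L (ℕ.m⊔n≤o⇒m≤o (K ℕ.⊔ L) (N ℕ.⊔ M) ≤i)
         L≤j = ℕ.m⊔n≤o⇒n≤o K L (ℕ.m⊔n≤o⇒m≤o (K ℕ.⊔ L) (N ℕ.⊔ M) ≤j)
         ≤i′ = ℕ.m⊔n≤o⇒n≤o (K ℕ.⊔ L) (N ℕ.⊔ M) ≤i
         ≤j′ = ℕ.m⊔n≤o⇒n≤o (K ℕ.⊔ L) (N ℕ.⊔ M) ≤j
         a = seq x i ; b = seq y i ; c = seq x j ; d = seq y j
     in ℚ.≤-<-trans
       (*-dist a b c d)
       (subst (_ ℚ.<_) (trans (cong₂ ℚ._+_ Bδ Cη) (½+½ ε)) (ℚ.+-mono-<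
         (*-small a (b ℚ.- d) B>0 (hB i K≤i)
           (hy i j (ℕ.m⊔n≤o⇒n≤o N M ≤i′) (ℕ.m⊔n≤o⇒n≤o N M ≤j′)))
         (*-small d (a ℚ.- c) C>0 (hC j L≤j)
           (hx i j (ℕ.m⊔n≤o⇒m≤o N M ≤i′) (ℕ.m⊔n≤o⇒m≤o N M ≤j′)))))

-- The value at 0 is irrelevant: a positive real has eventually positive terms.
invℚ : ℚ → ℚ
invℚ q with q ℚ.≟ 0ℚ
... | yes _  = 0ℚ
... | no q≢0 = ℚ.1/_ q {{ℚ.≢-nonZero q≢0}}

private
  invℚ-inverse : ∀ {q} → 0ℚ ℚ.< q → invℚ q ℚ.* q ≡ 1ℚ
  invℚ-inverse {q} q>0 with q ℚ.≟ 0ℚ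
  ... | yes q≡0 = ⊥-elim (ℚ.<-irrefl (sym q≡0) q>0)
  ... | no q≢0  = ℚ.*-inverseˡ q {{ℚ.≢-nonZero q≢0}}

  invℚ-dist : ∀ {e ε} a b → 0ℚ ℚ.< e → e ℚ.≤ a → e ℚ.≤ b →
              ℚ.∣ a ℚ.- b ∣ ℚ.< ε ℚ.* (e ℚ.* e) → ℚ.∣ invℚ a ℚ.- invℚ b ∣ ℚ.< ε
  invℚ-dist {e} {ε} a b e>0 e≤a e≤b h =
    ℚ.*-cancelʳ-<-nonNeg (e ℚ.* e) {{ℚ.pos⇒nonNeg (e ℚ.* e) {{ℚ.positive (*-pos e>0 e>0)}}}}
      (ℚ.≤-<-trans
        (ℚ.≤-trans (ℚ.*-monoˡ-≤-nonNeg t {{ℚ.∣-∣-nonNeg (invℚ a ℚ.- invℚ b)}} ee≤ab)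
                   (ℚ.≤-reflexive t*ab))
        h)
    where
      t = ℚ.∣ invℚ a ℚ.- invℚ b ∣
      a>0 = ℚ.<-≤-trans e>0 e≤a
      b>0 = ℚ.<-≤-trans e>0 e≤b
      ee≤ab : e ℚ.* e ℚ.≤ a ℚ.* b
      ee≤ab = ℚ.≤-trans
        (ℚ.*-monoˡ-≤-nonNeg e {{ℚ.pos⇒nonNeg e {{ℚ.positive e>0}}}} e≤b)
        (ℚ.*-monoʳ-≤-nonNeg b {{ℚ.pos⇒nonNeg b {{ℚ.positive b>0}}}} e≤a)
      expand : (invℚ a ℚ.- invℚ b) ℚ.* (a ℚ.* b) ≡ b ℚ.- a
      expand = trans
        (solve 4 (λ a b u v → (u :- v) :* (a :* b) := (u :* a) :* b :- (v :* b) :* a) refl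
          a b (invℚ a) (invℚ b))
        (cong₂ ℚ._-_
          (trans (cong (ℚ._* b) (invℚ-inverse a>0)) (ℚ.*-identityˡ b))
          (trans (cong (ℚ._* a) (invℚ-inverse b>0)) (ℚ.*-identityˡ a)))
      ab≥0 : 0ℚ ℚ.≤ a ℚ.* b
      ab≥0 = ℚ.<⇒≤ (*-pos a>0 b>0)
      t*ab : t ℚ.* (a ℚ.* b) ≡ ℚ.∣ a ℚ.- b ∣
      t*ab = trans (cong (t ℚ.*_) (sym (ℚ.0≤p⇒∣p∣≡p ab≥0)))
        (trans (sym (ℚ.∣p*q∣≡∣p∣*∣q∣ (invℚ a ℚ.- invℚ b) (a ℚ.* b)))
          (trans (cong ℚ.∣_∣ expand) (swap-dist b a)))

recip : (x : ℝ) → 0ℝ <ℝ x → ℝ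
recip x (e , e>0 , K , h) = mkℝ (invℚ ∘ seq x) λ ε ε>0 →
  let N , hx = cauchy x (ε ℚ.* (e ℚ.* e)) (*-pos ε>0 (*-pos e>0 e>0))
      low : ∀ i → K ℕ.⊔ N ℕ.≤ i → e ℚ.≤ seq x i
      low i ≤i = subst (ℚ._≤ seq x i) (ℚ.+-identityˡ e) (h i (ℕ.m⊔n≤o⇒m≤o K N ≤i))
  in K ℕ.⊔ N , λ i j ≤i ≤j → invℚ-dist (seq x i) (seq x j) e>0 (low i ≤i) (low j ≤j)
       (hx i j (ℕ.m⊔n≤o⇒n≤o K N ≤i) (ℕ.m⊔n≤o⇒n≤o K N ≤j))

recip-inverse : ∀ x (x>0 : 0ℝ <ℝ x) → recip x x>0 *ℝ x ≃ 1ℝ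
recip-inverse x (e , e>0 , K , h) ε ε>0 = K , λ i K≤i →
  let e≤x = subst (ℚ._≤ seq x i) (ℚ.+-identityˡ e) (h i K≤i)
      eq  = cong (λ t → ℚ.∣ t ℚ.- 1ℚ ∣) (invℚ-inverse (ℚ.<-≤-trans e>0 e≤x))
  in subst (ℚ._< ε) (sym eq) ε>0

0<1 : 0ℝ <ℝ 1ℝ
0<1 = 1ℚ , ℚ.positive⁻¹ 1ℚ , 0 , λ _ _ → ℚ.≤-refl

0<* : ∀ x y → 0ℝ <ℝ x → 0ℝ <ℝ y → 0ℝ <ℝ x *ℝ y
0<* x y (d , d>0 , N , hx) (e , e>0 , M , hy) = d ℚ.* e , *-pos d>0 e>0 , N ℕ.⊔ M , λ i ≤i →
  let d≤x = subst (ℚ._≤ seq x i) (ℚ.+-identityˡ d) (hx i (ℕ.m⊔n≤o⇒m≤o N M ≤i))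
      e≤y = subst (ℚ._≤ seq y i) (ℚ.+-identityˡ e) (hy i (ℕ.m⊔n≤o⇒n≤o N M ≤i))
      x>0 = ℚ.<-≤-trans d>0 d≤x
  in subst (ℚ._≤ seq x i ℚ.* seq y i) (sym (ℚ.+-identityˡ (d ℚ.* e))) (ℚ.≤-trans
       (ℚ.*-monoʳ-≤-nonNeg e {{ℚ.pos⇒nonNeg e {{ℚ.positive e>0}}}} d≤x)
       (ℚ.*-monoˡ-≤-nonNeg (seq x i) {{ℚ.pos⇒nonNeg (seq x i) {{ℚ.positive x>0}}}} e≤y))

sumℝ productℝ : List ℝ → ℝ
sumℝ     = foldr _+ℝ_ 0ℝ
productℝ = foldr _*ℝ_ 1ℝ

ConvergesTo : (ℕ → ℝ) → ℝ → Set
ConvergesTo x ℓ = ∀ ε → 0ℚ ℚ.< ε → ∃ λ N → ∀ k → N ℕ.≤ k → ∣ x k -ℝ ℓ ∣ℝ <ℝ fromℚ ε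

SumsTo : (ℕ → ℝ) → ℝ → Set
SumsTo x s = ConvergesTo (λ K → sumℝ (applyUpTo x K)) s

------------------------------------------------------------------------
-- The letter i of {1,…,m} is the i-th element of Fin m.

Word : ℕ → Set
Word m = List (Fin m)

P : ∀ {m} → (Fin m → ℝ) → Word m → ℝ
P p w = productℝ (map p w)

P-pos : ∀ {m} (p : Fin m → ℝ) {w} → All (λ i → 0ℝ <ℝ p i) w → 0ℝ <ℝ P p w
P-pos p []                  = 0<1
P-pos p {i ∷ w} (pᵢ>0 ∷ ps) = 0<* (p i) (P p w) pᵢ>0 (P-pos p ps)

words : ∀ m → ℕ → List (Word m)
words m zero    = [] ∷ []
words m (suc k) = cartesianProductWith _∷_ (allFin m) (words m k)

∈-words : ∀ {m k} {w : Word m} → w ∈ words m k ⇔ length w ≡ k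
∈-words {m} {k} = mk⇔ (to k) (from k)
  where
    to : ∀ k {w : Word m} → w ∈ words m k → length w ≡ k
    to zero    (here refl) = refl
    to (suc k) w∈ with _ , _ , _ , v∈ , refl ← ∈-cartesianProductWith⁻ _∷_ (allFin m) (words m k) w∈
      = cong suc (to k v∈)
    from : ∀ k {w : Word m} → length w ≡ k → w ∈ words m k
    from zero    {[]}    refl = here refl
    from (suc k) {i ∷ w} refl = ∈-cartesianProductWith⁺ _∷_ (∈-allFin i) (from k refl)

words-unique : ∀ m k → Unique (words m k)
words-unique m zero    = [] ∷ []
words-unique m (suc k) = Unique.cartesianProductWith⁺ _∷_ ∷-injective (Unique.allFin⁺ m) (words-unique m k)

Overlap : ∀ {m} → Word m → Word m → Set
Overlap S R = R ≢ [] × Prefix _≡_ R S × Suffix _≡_ R S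

overlap? : ∀ {m} (S : Word m) → Decidable (Overlap S)
overlap? S R = ¬? (≡-dec _≟ᶠ_ R []) ×-dec prefix? _≟ᶠ_ R S ×-dec suffix? _≟ᶠ_ R S

overlaps : ∀ {m} → Word m → List (Word m)
overlaps S = filter (overlap? S) (inits S)

∈-overlaps : ∀ {m} {S R : Word m} → R ∈ overlaps S ⇔ Overlap S R
∈-overlaps {S = S} = mk⇔
  (λ R∈ → proj₂ (∈-filter⁻ (overlap? S) {xs = inits S} R∈))
  (λ o → ∈-filter⁺ (overlap? S) (prefix⇒∈inits (proj₁ (proj₂ o))) o)
  where
    prefix⇒∈inits : ∀ {m} {R S : Word m} → Prefix _≡_ R S → R ∈ inits S
    prefix⇒∈inits []         = here refl
    prefix⇒∈inits (refl ∷ r) = there (∈-map⁺ _ (prefix⇒∈inits r))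

overlaps-unique : ∀ {m} (S : Word m) → Unique (overlaps S)
overlaps-unique S = Unique.filter⁺ (overlap? S) (inits-unique S)
  where
    inits-unique : ∀ {m} (S : Word m) → Unique (inits S)
    inits-unique []      = [] ∷ []
    inits-unique (i ∷ S) =
      All.map⁺ (All.universal (λ _ ()) (inits S)) ∷
      Unique.map⁺ ∷-injectiveʳ (inits-unique S)

overlap-letters : ∀ {m ℓ} {Q : Pred (Fin m) ℓ} {S R : Word m} → R ∈ overlaps S → All Q S → All Q R
overlap-letters R∈ = go (proj₁ (proj₂ (Equivalence.to ∈-overlaps R∈)))
  where
    go : ∀ {m ℓ} {Q : Pred (Fin m) ℓ} {S R : Word m} → Prefix _≡_ R S → All Q S → All Q R
    go []         _        = []
    go (refl ∷ r) (q ∷ qs) = q ∷ go r qs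

-- Σ_{R ∈ overlap(S)} ((1-|R|)^b - (-|R|)^b) / P(R)
overlapSum : ∀ {m} (p : Fin m → ℝ) (S : Word m) → All (λ i → 0ℝ <ℝ p i) S → ℕ → ℝ
overlapSum p S S>0 b = sumℝ (mapWith∈ (overlaps S) λ {R} R∈ →
  fromℤ ((ℤ.1ℤ ℤ.- + length R) ℤ.^ b ℤ.- (ℤ.- (+ length R)) ℤ.^ b)
    *ℝ recip (P p R) (P-pos p (overlap-letters R∈ S>0)))

------------------------------------------------------------------------

record IsSetPartition {n} (π : List (Subset n)) : Set where
  field
    nonempty : All Nonempty π
    disjoint : AllPairs (λ B C → ∀ {x} → x ∈ˢ B → ¬ x ∈ˢ C) π
    covers   : ∀ x → Any (x ∈ˢ_) π

-- All partitions of Fin (suc n) restricting to a given partition of Fin n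
-- (shifted by suc): zero joins one of the blocks or is a block of its own.
insertZero : ∀ {n} → List (Subset n) → List (List (Subset (suc n)))
insertZero []      = ((inside ∷ ∅) ∷ []) ∷ []
insertZero (B ∷ π) = ((inside ∷ B) ∷ map (outside ∷_) π) ∷ map ((outside ∷ B) ∷_) (insertZero π)

setPartitions : ∀ n → List (List (Subset n))
setPartitions zero    = [] ∷ []
setPartitions (suc n) = concatMap insertZero (setPartitions n)

private
  variable
    n : ℕ
    B C : Subset n
    π ρ σ : List (Subset n)

  Disjoint : Subset n → Subset n → Set
  Disjoint B C = ∀ {x} → x ∈ˢ B → ¬ x ∈ˢ C

  Disjoint-out : ∀ {s} → Disjoint B C → Disjoint (outside ∷ B) (s ∷ C)
  Disjoint-out d (there x∈B) (there x∈C) = d x∈B x∈C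

  Disjoint-in : Disjoint B C → Disjoint (inside ∷ B) (outside ∷ C)
  Disjoint-in d (there x∈B) (there x∈C) = d x∈B x∈C

  Disjoint-tail : ∀ {s t} → Disjoint (s ∷ B) (t ∷ C) → Disjoint B C
  Disjoint-tail d x∈B x∈C = d (there x∈B) (there x∈C)

  lift-nonempty : ∀ {s} → Nonempty B → Nonempty (s ∷ B)
  lift-nonempty (x , x∈B) = suc x , there x∈B

  insert-nonempty : All Nonempty π → ρ ∈ insertZero π → All Nonempty ρ
  insert-nonempty []        (here refl) = (zero , here) ∷ []
  insert-nonempty (b ∷ bs)  (here refl) = (zero , here) ∷ All.map⁺ (All.map lift-nonempty bs)
  insert-nonempty (b ∷ bs)  (there ρ∈) with _ , ρ∈′ , refl ← ∈-map⁻ _ ρ∈ =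
    lift-nonempty b ∷ insert-nonempty bs ρ∈′

  insert-disjoint₁ : All (Disjoint B) π → ρ ∈ insertZero π → All (Disjoint (outside ∷ B)) ρ
  insert-disjoint₁ []       (here refl) = (Disjoint-out λ _ x∈∅ → Subset.∉⊥ x∈∅) ∷ []
  insert-disjoint₁ (d ∷ ds) (here refl) = Disjoint-out d ∷ All.map⁺ (All.map Disjoint-out ds)
  insert-disjoint₁ (d ∷ ds) (there ρ∈) with _ , ρ∈′ , refl ← ∈-map⁻ _ ρ∈ =
    Disjoint-out d ∷ insert-disjoint₁ ds ρ∈′

  insert-disjoint : AllPairs Disjoint π → ρ ∈ insertZero π → AllPairs Disjoint ρ
  insert-disjoint []       (here refl) = [] ∷ []
  insert-disjoint (d ∷ ds) (here refl) =
    All.map⁺ (All.map Disjoint-in d) ∷ AllPairs.map⁺ (AllPairs.map Disjoint-out ds)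
  insert-disjoint (d ∷ ds) (there ρ∈) with _ , ρ∈′ , refl ← ∈-map⁻ _ ρ∈ =
    insert-disjoint₁ d ρ∈′ ∷ insert-disjoint ds ρ∈′

  insert-covers-zero : ∀ π → ρ ∈ insertZero {n} π → Any (zero ∈ˢ_) ρ
  insert-covers-zero []      (here refl) = here here
  insert-covers-zero (B ∷ π) (here refl) = here here
  insert-covers-zero (B ∷ π) (there ρ∈) with _ , ρ∈′ , refl ← ∈-map⁻ _ ρ∈ =
    there (insert-covers-zero π ρ∈′)

  insert-covers-suc : ∀ {x} → Any (x ∈ˢ_) π → ρ ∈ insertZero π → Any (suc x ∈ˢ_) ρ
  insert-covers-suc (here x∈B)  (here refl) = here (there x∈B)
  insert-covers-suc (there x∈π) (here refl) = there (Any.map⁺ (Any.map there x∈π))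
  insert-covers-suc (here x∈B)  (there ρ∈) with _ , _ , refl ← ∈-map⁻ _ ρ∈ = here (there x∈B)
  insert-covers-suc (there x∈π) (there ρ∈) with _ , ρ∈′ , refl ← ∈-map⁻ _ ρ∈ =
    there (insert-covers-suc x∈π ρ∈′)

setPartitions-sound : ∀ n {π} → π ∈ setPartitions n → IsSetPartition π
setPartitions-sound zero    (here refl) = record { nonempty = [] ; disjoint = [] ; covers = λ () }
setPartitions-sound (suc n) π∈
  with π , π′∈ , ρ∈ ← find (∈-concatMap⁻ insertZero {xs = setPartitions n} π∈) = record
  { nonempty = insert-nonempty nonempty ρ∈
  ; disjoint = insert-disjoint disjoint ρ∈
  ; covers   = λ { zero → insert-covers-zero π ρ∈ ; (suc x) → insert-covers-suc (covers x) ρ∈ }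
  }
  where open IsSetPartition (setPartitions-sound n π′∈)

private
  partition-resp-↭ : π ↭ ρ → IsSetPartition π → IsSetPartition ρ
  partition-resp-↭ π↭ρ p = record
    { nonempty = ↭.All-resp-↭ π↭ρ nonempty
    ; disjoint = AllPairs-resp π↭ρ disjoint
    ; covers   = ↭.Any-resp-↭ π↭ρ ∘ covers
    }
    where
      open IsSetPartition p
      AllPairs-resp : π ↭ ρ → AllPairs Disjoint π → AllPairs Disjoint ρ
      AllPairs-resp ↭.refl          ds = ds
      AllPairs-resp (prep x π↭ρ)  (d ∷ ds) = ↭.All-resp-↭ π↭ρ d ∷ AllPairs-resp π↭ρ ds
      AllPairs-resp (swap x y π↭ρ) ((d ∷ dx) ∷ dy ∷ ds) =
        ((λ y∈ x∈ → d x∈ y∈) ∷ ↭.All-resp-↭ π↭ρ dy) ∷ ↭.All-resp-↭ π↭ρ dx ∷ AllPairs-resp π↭ρ ds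
      AllPairs-resp (↭.trans s t)   ds = AllPairs-resp t (AllPairs-resp s ds)

  insert-own : ∀ (π : List (Subset n)) →
    ∃ λ ρ → ρ ∈ insertZero π × ρ ↭ (inside ∷ ∅) ∷ map (outside ∷_) π
  insert-own []      = _ , here refl , ↭-refl
  insert-own (B ∷ π) with ρ , ρ∈ , ρ↭ ← insert-own π =
    _ , there (∈-map⁺ _ ρ∈) , ↭-trans (prep _ ρ↭) (swap _ _ ↭-refl)

  insert-join : B ∈ π →
    ∃ λ ρ → ∃ λ σ → ρ ∈ insertZero π × π ↭ B ∷ σ × ρ ↭ (inside ∷ B) ∷ map (outside ∷_) σ
  insert-join {π = B ∷ π} (here refl) = _ , π , here refl , ↭-refl , ↭-refl
  insert-join {π = C ∷ π} (there B∈) with ρ , σ , ρ∈ , π↭ , ρ↭ ← insert-join B∈ =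
    _ , C ∷ σ , there (∈-map⁺ _ ρ∈) , ↭-trans (prep _ π↭) (swap _ _ ↭-refl)
      , ↭-trans (prep _ ρ↭) (swap _ _ ↭-refl)

  split-zero : {π : List (Subset (suc n))} → IsSetPartition π →
    ∃ λ B → ∃ λ σ → π ↭ (inside ∷ B) ∷ map (outside ∷_) σ
  split-zero p with find (IsSetPartition.covers p zero)
  ... | (inside ∷ B) , B∈π , here with xs , ys , refl ← ∈-∃++ B∈π
    = let q = partition-resp-↭ (↭.shift (inside ∷ B) xs ys) p
          σ , eq = unlift (headDisjoint (IsSetPartition.disjoint q))
      in B , σ , ↭-trans (↭.shift (inside ∷ B) xs ys) (prep _ (↭-reflexive eq))
    where
      headDisjoint : ∀ {B : Subset n} {ρ} → AllPairs Disjoint (B ∷ ρ) → All (Disjoint B) ρ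
      headDisjoint (d ∷ _) = d
      unlift : ∀ {ρ} → All (Disjoint (inside ∷ B)) ρ → ∃ λ σ → ρ ≡ map (outside ∷_) σ
      unlift [] = [] , refl
      unlift {(inside ∷ C) ∷ ρ}  (d ∷ ds) = ⊥-elim (d here here)
      unlift {(outside ∷ C) ∷ ρ} (d ∷ ds) with σ , refl ← unlift ds = C ∷ σ , refl

  restrict : IsSetPartition {suc n} ((inside ∷ B) ∷ map (outside ∷_) σ) →
             All Nonempty σ × AllPairs Disjoint (B ∷ σ) × (∀ x → Any (x ∈ˢ_) (B ∷ σ))
  restrict {B = B} {σ = σ} p with IsSetPartition.nonempty p | IsSetPartition.disjoint p
  ... | _ ∷ ne | d ∷ ds =
      All.map (λ { (suc x , there x∈) → x , x∈ }) (All.map⁻ ne)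
    , All.map Disjoint-tail (All.map⁻ d) ∷ ds-tail σ ds
    , λ x → cover-tail (IsSetPartition.covers p (suc x))
    where
      ds-tail : ∀ σ → AllPairs Disjoint (map (outside ∷_) σ) → AllPairs Disjoint σ
      ds-tail []      _        = []
      ds-tail (C ∷ σ) (d ∷ ds) = All.map Disjoint-tail (All.map⁻ d) ∷ ds-tail σ ds
      cover-tail : ∀ {x} → Any (suc x ∈ˢ_) ((inside ∷ B) ∷ map (outside ∷_) σ) → Any (x ∈ˢ_) (B ∷ σ)
      cover-tail (here (there x∈)) = here x∈
      cover-tail (there a)         = there (Any.map (λ { (there x∈) → x∈ }) (Any.map⁻ a))

setPartitions-complete : ∀ n {π} → IsSetPartition {n} π → ∃ λ ρ → ρ ∈ setPartitions n × π ↭ ρ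
setPartitions-complete zero {[]} p = [] , here refl , ↭-refl
setPartitions-complete zero {B ∷ π} p with (() , _) ∷ _ ← IsSetPartition.nonempty p
setPartitions-complete (suc n) {π} p with B , σ , π↭ ← split-zero p
  with ne , ds , cov ← restrict (partition-resp-↭ π↭ p) | Subset.nonempty? B
... | yes b =
  let ρ , ρ∈ , ↭ρ = setPartitions-complete n (record { nonempty = b ∷ ne ; disjoint = ds ; covers = cov })
      τ , σ′ , τ∈ , ρ↭ , τ↭ = insert-join (↭.∈-resp-↭ ↭ρ (here refl))
      σ↭σ′ = ↭.drop-∷ (↭-trans ↭ρ ρ↭)
  in τ , ∈-concatMap⁺ insertZero (Any.map (λ { refl → τ∈ }) ρ∈)
       , ↭-trans π↭ (↭-trans (prep _ (↭.map⁺ _ σ↭σ′)) (↭-sym τ↭))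
... | no ¬b with refl ← Subset.Empty-unique ¬b =
  let ρ , ρ∈ , σ↭ρ = setPartitions-complete n (record
        { nonempty = ne ; disjoint = tailPairs ds ; covers = λ x → drop∅ (cov x) })
      τ , τ∈ , τ↭ = insert-own ρ
  in τ , ∈-concatMap⁺ insertZero (Any.map (λ { refl → τ∈ }) ρ∈)
       , ↭-trans π↭ (↭-trans (prep _ (↭.map⁺ _ σ↭ρ)) (↭-sym τ↭))
  where
    tailPairs : ∀ {B : Subset n} {σ} → AllPairs Disjoint (B ∷ σ) → AllPairs Disjoint σ
    tailPairs (_ ∷ ds) = ds
    drop∅ : ∀ {x : Fin n} {σ} → Any (x ∈ˢ_) (∅ ∷ σ) → Any (x ∈ˢ_) σ
    drop∅ (here x∈∅) = ⊥-elim (Subset.∉⊥ x∈∅)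
    drop∅ (there a)  = a

private
  insert-blocks : ∀ (π : List (Subset n)) → ρ ∈ insertZero π → (inside ∷ B) ∈ ρ → B ∈ π ⊎ B ≡ ∅
  insert-blocks []      (here refl) (here refl) = inj₂ refl
  insert-blocks (C ∷ π) (here refl) (here refl) = inj₁ (here refl)
  insert-blocks (C ∷ π) (here refl) (there B∈) with _ , _ , () ← ∈-map⁻ _ B∈
  insert-blocks (C ∷ π) (there ρ∈) B∈ with ∈-map⁻ _ ρ∈
  insert-blocks (C ∷ π) (there ρ∈) (there B∈) | _ , ρ∈′ , refl with insert-blocks π ρ∈′ B∈
  ... | inj₁ B∈π = inj₁ (there B∈π)
  ... | inj₂ B≡∅ = inj₂ B≡∅

  insert-distinct : All Nonempty π → AllPairs Disjoint π → AllPairs (λ ρ σ → ¬ (ρ ↭ σ)) (insertZero π)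
  insert-distinct {π = []}    _ _ = [] ∷ []
  insert-distinct {π = B ∷ π} (b ∷ bs) (d ∷ ds) =
      All.map⁺ (All.tabulate new) ∷
      AllPairs.map⁺ (AllPairs.map (_∘ ↭.drop-∷) (insert-distinct bs ds))
    where
      new : ∀ {ρ} → ρ ∈ insertZero π → ¬ ((inside ∷ B) ∷ map (outside ∷_) π ↭ (outside ∷ B) ∷ ρ)
      new ρ∈ ↭ρ with ↭.∈-resp-↭ ↭ρ (here refl)
      ... | there B∈ with insert-blocks π ρ∈ B∈
      ...   | inj₁ B∈π  = All.lookup d B∈π (proj₂ b) (proj₂ b)
      ...   | inj₂ refl = Subset.∉⊥ (proj₂ b)

  restriction : List (Subset (suc n)) → List (Subset n)
  restriction = filter Subset.nonempty? ∘ map Vec.tail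

  restriction-map : All Nonempty π → restriction (map (outside ∷_) π) ≡ π
  restriction-map {π = π} ne = trans (cong (filter _) (sym (map-∘ π))) (trans (cong (filter _) (map-id π)) (filter-all Subset.nonempty? ne))

  restriction-insert : All Nonempty π → ρ ∈ insertZero π → restriction ρ ≡ π
  restriction-insert [] (here refl) = filter-reject Subset.nonempty? (λ (_ , x∈) → Subset.∉⊥ x∈)
  restriction-insert {π = B ∷ π} (b ∷ bs) (here refl) =
    trans (filter-accept Subset.nonempty? b) (cong (B ∷_) (restriction-map bs))
  restriction-insert {π = B ∷ π} (b ∷ bs) (there ρ∈) with _ , ρ∈′ , refl ← ∈-map⁻ _ ρ∈ =
    trans (filter-accept Subset.nonempty? b) (cong (B ∷_) (restriction-insert bs ρ∈′))

setPartitions-distinct : ∀ n → AllPairs (λ π ρ → ¬ (π ↭ ρ)) (setPartitions n)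
setPartitions-distinct zero    = [] ∷ []
setPartitions-distinct (suc n) = go (setPartitions n) (All.tabulate (setPartitions-sound n)) (setPartitions-distinct n)
  where
    go : ∀ πs → All IsSetPartition πs → AllPairs (λ π ρ → ¬ (π ↭ ρ)) πs →
         AllPairs (λ π ρ → ¬ (π ↭ ρ)) (concatMap insertZero πs)
    go []       _        _        = []
    go (π ∷ πs) (p ∷ ps) (d ∷ ds) =
      AllPairs.++⁺ (insert-distinct (nonempty p) (disjoint p)) (go πs ps ds)
        (All.tabulate λ ρ∈ → All.tabulate λ σ∈ ρ↭σ →
          let π′ , π′∈ , σ∈′ = find (∈-concatMap⁻ insertZero {xs = πs} σ∈)
          in All.lookup d π′∈ (subst₂ _↭_
               (restriction-insert (nonempty p) ρ∈)
               (restriction-insert (nonempty (All.lookup ps π′∈)) σ∈′)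
               (↭.filter-↭ Subset.nonempty? (↭.map⁺ Vec.tail ρ↭σ))))
      where open IsSetPartition

------------------------------------------------------------------------

Ω : ℕ → Set
Ω m = ℕ → Fin m

rolls : ∀ {m} → Ω m → ℕ → Word m
rolls ω k = applyUpTo ω k

-- An event of the infinite product space determined by the first `horizon` rolls.
record Event (m : ℕ) : Set₁ where
  field
    Holds    : Ω m → Set
    horizon  : ℕ
    Base     : Word m → Set
    base?    : Decidable Base
    cylinder : ∀ ω → Holds ω ⇔ Base (rolls ω horizon)
open Event public

-- Product measure of a cylinder event.
Pr : ∀ {m} → (Fin m → ℝ) → Event m → ℝ
Pr {m} p E = sumℝ (map (P p) (filter (base? E) (words m (horizon E))))

-- A random variable with values in ℕ ∪ {∞}, given by the events {Y = k}, k ∈ ℕ.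
record RandomTime (m : ℕ) : Set₁ where
  field
    equals     : ℕ → Event m
    functional : ∀ ω j k → Holds (equals j) ω → Holds (equals k) ω → j ≡ k
open RandomTime public

-- E(f(Y)) = v for a nonnegative f: Y is almost surely finite and Σ_k f(k) P(Y = k) = v.
HasExpectation : ∀ {m} → (Fin m → ℝ) → RandomTime m → (ℕ → ℕ) → ℝ → Set
HasExpectation p Y f v =
  SumsTo (λ k → Pr p (equals Y k)) 1ℝ ×
  SumsTo (λ k → fromℕ (f k) *ℝ Pr p (equals Y k)) v

waitingTime : ∀ {m} → Word m → RandomTime m
waitingTime {m} S = record { equals = firstAt ; functional = λ ω j k → unique ω }
  where
    firstAt : ℕ → Event m
    firstAt k = record
      { Holds    = λ ω → Infix _≡_ S (rolls ω k) × (∀ {j} → j ℕ.< k → ¬ Infix _≡_ S (rolls ω j))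
      ; horizon  = k
      ; Base     = λ w → Infix _≡_ S w × (∀ {j} → j ℕ.< k → ¬ Infix _≡_ S (take j w))
      ; base?    = λ w → infix? _≟ᶠ_ S w ×-dec
                         ℕ.allUpTo? (λ j → ¬? (infix? _≟ᶠ_ S (take j w))) k
      ; cylinder = λ ω → mk⇔
          (λ (s , first) → s , λ j<k → first j<k ∘ subst (Infix _≡_ S) (take-rolls ω (ℕ.<⇒≤ j<k)))
          (λ (s , first) → s , λ j<k → first j<k ∘ subst (Infix _≡_ S) (sym (take-rolls ω (ℕ.<⇒≤ j<k))))
      }
      where
        take-rolls : ∀ {j k} (ω : Ω m) → j ℕ.≤ k → take j (rolls ω k) ≡ rolls ω j
        take-rolls ω z≤n       = refl
        take-rolls ω (s≤s j≤k) = cong (ω 0 ∷_) (take-rolls (ω ∘ suc) j≤k)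

    unique : ∀ ω {j k} → Holds (firstAt j) ω → Holds (firstAt k) ω → j ≡ k
    unique ω {j} {k} (sⱼ , firstⱼ) (sₖ , firstₖ) with ℕ.<-cmp j k
    ... | tri< j<k _ _ = ⊥-elim (firstₖ j<k sⱼ)
    ... | tri≈ _ j≡k _ = j≡k
    ... | tri> _ _ k<j = ⊥-elim (firstⱼ k<j sₖ)

{-# OPTIONS --safe #-}
-- Write a k = P(Y = k) and t k = P(Y > k).  If the first k rolls avoid S and are followed by S,
-- then S is first completed after reading some prefix R of this last copy, and R is an overlap;
-- hence t k = Σ_R a (k + |R|) / P(R).  Together with t k = a (k + 1) + t (k + 1), summation by
-- parts turns this into M = 1 + G M for the exponential generating function M of the moments
-- E(Yⁿ), where G = Σ_R (exp((1 − |R|) x) − exp(−|R| x)) / P(R).  So M = 1 / (1 − G), whence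
-- M′ = G′ M², and differentiating n times produces the sum over set partitions: each derivative
-- either falls on a factor G⁽ᵇ⁾ (the new element joins a block of size b) or on a power of M
-- (a new singleton block).  The truncation errors vanish because the renewal equation also gives
-- (j + 1) t (i + j) ≤ C t i, so t k decays faster than any power of k.
module Submission where

open import Algebra.Bundles using (CommutativeRing)
open import Algebra.Morphism.Structures using (IsRingHomomorphism)
import Algebra.Properties.Ring as RingProperties
import Algebra.Properties.Semiring.Exp as SemiringExp
import Algebra.Properties.Semiring.Mult as SemiringMult
import Algebra.Solver.Ring.NaturalCoefficients.Default as NaturalCoefficients
open import Data.Empty using (⊥-elim)
open import Data.Fin.Base using (Fin)
open import Data.Fin.Properties using () renaming (_≟_ to _≟ᶠ_)
open import Data.Fin.Subset using (Subset; Side; outside; ∣_∣) renaming (⊥ to ∅)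
open import Data.Fin.Subset.Properties using (∣⊥∣≡0)
open import Data.Integer.Base as ℤ using (ℤ)
import Data.Integer.Properties as ℤ
import Data.Integer.Solver as ℤ
open import Data.List.Base using (List; []; _∷_; _++_; _∷ʳ_; map; foldr; filter; concatMap; cartesianProductWith; length; applyUpTo; inits; drop; take; tabulate; allFin)
open import Data.List.Membership.Propositional using (_∈_; mapWith∈)
open import Data.List.Membership.Propositional.Properties using (∈-map⁻)
open import Data.List.Properties using (≡-dec; length-map; map-∘; map-tabulate; length-++; ++-identityʳ; ++-assoc; take-all; take++drop≡id; ∷ʳ-++)
open import Data.List.Relation.Binary.Infix.Heterogeneous as Infix using (Infix; MkView; _++ⁱ_; _ⁱ++_)
open import Data.List.Relation.Binary.Infix.Heterogeneous.Properties as Infix using (infix?)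
open import Data.List.Relation.Binary.Pointwise as Pointwise using (Pointwise-≡⇒≡; Pointwise-length)
open import Data.List.Relation.Binary.Prefix.Heterogeneous using (Prefix; []; _∷_)
import Data.List.Relation.Binary.Prefix.Heterogeneous.Properties as Prefix
open import Data.List.Relation.Binary.Suffix.Heterogeneous using (Suffix; here; there; _++ˢ_)
import Data.List.Relation.Binary.Suffix.Heterogeneous.Properties as Suffix
open import Data.List.Relation.Unary.All as All using (All; []; _∷_)
open import Data.List.Relation.Unary.AllPairs using ([]; _∷_)
open import Data.List.Relation.Unary.Any using (here; there)
open import Data.List.Relation.Unary.Unique.Propositional using (Unique)
open import Data.Nat.Base as ℕ using (ℕ; zero; suc; s≤s; z≤n; _!)
import Data.Nat.DivMod as ℕ
import Data.Nat.Properties as ℕ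
open import Data.Product.Base using (∃; _×_; _,_; proj₁; proj₂)
open import Data.Rational.Base as ℚ using (ℚ; 0ℚ; 1ℚ; ½)
import Data.Rational.Properties as ℚ
import Data.Rational.Solver as ℚ
open import Data.Rational.Unnormalised.Base as ℚᵘ using (mkℚᵘ; *≡*; *<*)
import Data.Rational.Unnormalised.Properties as ℚᵘ
open import Data.Sum.Base using (inj₁; inj₂)
open import Data.Vec.Base using (Vec; []; _∷_)
open import Function.Base using (_∘_; id)
open import Function.Bundles using (module Equivalence)
open import Level using (0ℓ)
open import Relation.Binary.Bundles using (Preorder)
open import Relation.Binary.PropositionalEquality as ≡ using (_≡_; _≢_; cong; subst; subst₂)
import Relation.Binary.Reasoning.Preorder as PreorderReasoning
import Relation.Binary.Reasoning.Setoid as SetoidReasoning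
open import Relation.Nullary using (¬_; yes; no; Dec)
open import Relation.Nullary.Decidable using (¬?)
open import Relation.Unary using (Pred; Decidable)
open import Defs

-- The equation M = 1 + G M cannot be used as it stands, because nothing says in advance that the
-- sums Σ a(k) kⁿ converge. So the truncated sums `moments k` carry the argument: they satisfy the
-- equation exactly up to boundary terms, and each coefficient of these terms is a null sequence in
-- `k`. The prospective limit `geometric` is built by pure algebra as a fixed point, which works in
-- any commutative ring because `G` has constant term 0. Convergence then comes from uniqueness:
-- multiplication by `geometric` inverts 1 - G, hence turns an approximate solution into an
-- approximation of `geometric`. The shape of `G` comes from undoing a shift. The renewal equation
-- trades t(k) for masses a(k + r) sitting r steps later, and the factors exp(-r x) bring their
-- weights exp((k + r) x) back to time k. Almost sure finiteness is obtained together with the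
-- moments, as the moment of order 0.

-- Finite sums in a commutative ring.

module Sums {c ℓ} (R : CommutativeRing c ℓ) where
  open CommutativeRing R
  open SetoidReasoning setoid
  open NaturalCoefficients commutativeSemiring using (solve; _:=_; _:+_; _:*_)

  ∑ : ∀ {a} {A : Set a} → List A → (A → Carrier) → Carrier
  ∑ xs f = foldr _+_ 0# (map f xs)

  module _ {a} {A : Set a} where

    ∑-cong : ∀ (xs : List A) {f g} → (∀ {x} → x ∈ xs → f x ≈ g x) → ∑ xs f ≈ ∑ xs g
    ∑-cong []       f≈g = refl
    ∑-cong (x ∷ xs) f≈g = +-cong (f≈g (here ≡.refl)) (∑-cong xs (f≈g ∘ there))

    ∑-zero : ∀ (xs : List A) {f} → (∀ {x} → x ∈ xs → f x ≈ 0#) → ∑ xs f ≈ 0#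
    ∑-zero []       f≈0 = refl
    ∑-zero (x ∷ xs) f≈0 = trans (+-cong (f≈0 (here ≡.refl)) (∑-zero xs (f≈0 ∘ there))) (+-identityˡ 0#)

    ∑-+ : ∀ (xs : List A) f g → ∑ xs (λ x → f x + g x) ≈ ∑ xs f + ∑ xs g
    ∑-+ []       f g = sym (+-identityˡ 0#)
    ∑-+ (x ∷ xs) f g = trans (+-congˡ (∑-+ xs f g))
      (solve 4 (λ a b c d → (a :+ b) :+ (c :+ d) := (a :+ c) :+ (b :+ d)) refl _ _ _ _)

    ∑-*ˡ : ∀ (xs : List A) c f → ∑ xs (λ x → c * f x) ≈ c * ∑ xs f
    ∑-*ˡ []       c f = sym (zeroʳ c)
    ∑-*ˡ (x ∷ xs) c f = trans (+-congˡ (∑-*ˡ xs c f)) (sym (distribˡ c _ _))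

    ∑-*ʳ : ∀ (xs : List A) c f → ∑ xs (λ x → f x * c) ≈ ∑ xs f * c
    ∑-*ʳ xs c f = trans (∑-cong xs λ _ → *-comm _ c) (trans (∑-*ˡ xs c f) (*-comm c _))

    ∑-++ : ∀ (xs ys : List A) f → ∑ (xs ++ ys) f ≈ ∑ xs f + ∑ ys f
    ∑-++ []       ys f = sym (+-identityˡ _)
    ∑-++ (x ∷ xs) ys f = trans (+-congˡ (∑-++ xs ys f)) (sym (+-assoc _ _ _))

    ∑-single : ∀ {xs : List A} {x} f → Unique xs → x ∈ xs → (∀ {y} → y ≢ x → f y ≈ 0#) → ∑ xs f ≈ f x
    ∑-single {x ∷ xs} f (x∉ ∷ _) (here ≡.refl) f≈0 =
      trans (+-congˡ (∑-zero xs λ y∈ → f≈0 (All.lookup x∉ y∈ ∘ ≡.sym))) (+-identityʳ _)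
    ∑-single {y ∷ xs} f (y∉ ∷ u) (there x∈) f≈0 =
      trans (+-cong (f≈0 (All.lookup y∉ x∈)) (∑-single f u x∈ f≈0)) (+-identityˡ _)

    ∑-filter : ∀ {p} {P : Pred A p} (P? : Decidable P) xs {f g} →
      (∀ {x} → x ∈ xs → P x → f x ≈ g x) → (∀ {x} → x ∈ xs → ¬ P x → g x ≈ 0#) →
      ∑ (filter P? xs) f ≈ ∑ xs g
    ∑-filter P? []       f≈g g≈0 = refl
    ∑-filter P? (x ∷ xs) {f} f≈g g≈0 with P? x
    ... | yes Px = +-cong (f≈g (here ≡.refl) Px) (∑-filter P? xs (f≈g ∘ there) (g≈0 ∘ there))
    ... | no ¬Px = trans (∑-filter P? xs (f≈g ∘ there) (g≈0 ∘ there))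
                     (sym (trans (+-congʳ (g≈0 (here ≡.refl) ¬Px)) (+-identityˡ _)))

  module _ {a b} {A : Set a} {B : Set b} where

    ∑-map : ∀ (h : A → B) xs f → ∑ (map h xs) f ≡ ∑ xs (f ∘ h)
    ∑-map h xs f = cong (foldr _+_ 0#) (≡.sym (map-∘ xs))

    ∑-concatMap : ∀ (h : A → List B) xs f → ∑ (concatMap h xs) f ≈ ∑ xs (λ x → ∑ (h x) f)
    ∑-concatMap h []       f = refl
    ∑-concatMap h (x ∷ xs) f = trans (∑-++ (h x) (concatMap h xs) f) (+-congˡ (∑-concatMap h xs f))

    ∑-cartesianProductWith : ∀ {d} {D : Set d} (h : A → B → D) xs ys f →
      ∑ (cartesianProductWith h xs ys) f ≈ ∑ xs (λ x → ∑ ys (λ y → f (h x y)))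
    ∑-cartesianProductWith h []       ys f = refl
    ∑-cartesianProductWith h (x ∷ xs) ys f = trans (∑-++ (map (h x) ys) _ f)
      (+-cong (reflexive (cong (foldr _+_ 0#) (≡.sym (map-∘ ys)))) (∑-cartesianProductWith h xs ys f))

  ∑< : ℕ → (ℕ → Carrier) → Carrier
  ∑< zero    x = 0#
  ∑< (suc k) x = ∑< k x + x k

  ∑<-suc : ∀ k x → ∑< (suc k) x ≈ x 0 + ∑< k (x ∘ suc)
  ∑<-suc zero    x = +-comm 0# (x 0)
  ∑<-suc (suc k) x = trans (+-congʳ (∑<-suc k x)) (+-assoc _ _ _)

  ∑<-applyUpTo : ∀ k x → foldr _+_ 0# (applyUpTo x k) ≈ ∑< k x
  ∑<-applyUpTo zero    x = refl
  ∑<-applyUpTo (suc k) x = trans (+-congˡ (∑<-applyUpTo k (x ∘ suc))) (sym (∑<-suc k x))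

-- Exponential generating functions and the geometric series.

-- The sequence f stands for the exponential generating function Σ f(n) xⁿ/n!;
-- its derivative is the shift, and ⊛ is defined so that Leibniz' rule holds by definition.
module Series {c ℓ} (R : CommutativeRing c ℓ) where
  open CommutativeRing R
  open SetoidReasoning setoid
  open NaturalCoefficients commutativeSemiring using (solve; _:=_; _:+_; _:*_)
  open SemiringExp semiring using (_^_; ^-congˡ)

  infix  4 _≋_
  infixl 6 _⊕_
  infixl 7 _⊛_ _·_

  Series : Set c
  Series = ℕ → Carrier

  _≋_ : Series → Series → Set ℓ
  f ≋ g = ∀ n → f n ≈ g n

  0ˢ 1ˢ : Series
  0ˢ _       = 0#
  1ˢ zero    = 1#
  1ˢ (suc n) = 0#

  _⊕_ _⊛_ : Series → Series → Series
  (f ⊕ g) n = f n + g n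
  (f ⊛ g) zero    = f 0 * g 0
  (f ⊛ g) (suc n) = ((f ∘ suc) ⊛ g) n + (f ⊛ (g ∘ suc)) n

  ⊝_ ∂ : Series → Series
  (⊝ f) n = - f n
  ∂ f = f ∘ suc

  _·_ : Carrier → Series → Series
  (a · f) n = a * f n

  -- Coefficient `n` of a product reads only coefficients up to `n` of the factors. `raise` depends
  -- on this, since the series compared there agree only in low degrees.
  ⊛-cong≤ : ∀ n {f f′ g g′} → (∀ {k} → k ℕ.≤ n → f k ≈ f′ k) → (∀ {k} → k ℕ.≤ n → g k ≈ g′ k) →
            (f ⊛ g) n ≈ (f′ ⊛ g′) n
  ⊛-cong≤ zero    f≈ g≈ = *-cong (f≈ ℕ.z≤n) (g≈ ℕ.z≤n)
  ⊛-cong≤ (suc n) f≈ g≈ = +-cong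
    (⊛-cong≤ n (f≈ ∘ ℕ.s≤s) (g≈ ∘ ℕ.m≤n⇒m≤1+n)) (⊛-cong≤ n (f≈ ∘ ℕ.m≤n⇒m≤1+n) (g≈ ∘ ℕ.s≤s))

  ⊛-cong : ∀ {f f′ g g′} → f ≋ f′ → g ≋ g′ → f ⊛ g ≋ f′ ⊛ g′
  ⊛-cong f≈ g≈ n = ⊛-cong≤ n (λ _ → f≈ _) (λ _ → g≈ _)

  ⊛-comm : ∀ f g → f ⊛ g ≋ g ⊛ f
  ⊛-comm f g zero    = *-comm (f 0) (g 0)
  ⊛-comm f g (suc n) = trans (+-cong (⊛-comm (∂ f) g n) (⊛-comm f (∂ g) n)) (+-comm _ _)

  ⊛-distribʳ : ∀ h f g → (f ⊕ g) ⊛ h ≋ f ⊛ h ⊕ g ⊛ h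
  ⊛-distribʳ h f g zero    = distribʳ (h 0) (f 0) (g 0)
  ⊛-distribʳ h f g (suc n) = trans
    (+-cong (⊛-distribʳ h (∂ f) (∂ g) n) (⊛-distribʳ (∂ h) f g n))
    (solve 4 (λ a b c d → (a :+ b) :+ (c :+ d) := (a :+ c) :+ (b :+ d)) refl _ _ _ _)

  ⊛-distribˡ : ∀ h f g → h ⊛ (f ⊕ g) ≋ h ⊛ f ⊕ h ⊛ g
  ⊛-distribˡ h f g n = trans (⊛-comm h (f ⊕ g) n)
    (trans (⊛-distribʳ h f g n) (+-cong (⊛-comm f h n) (⊛-comm g h n)))

  ⊛-assoc : ∀ f g h → (f ⊛ g) ⊛ h ≋ f ⊛ (g ⊛ h)
  ⊛-assoc f g h zero    = *-assoc (f 0) (g 0) (h 0)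
  ⊛-assoc f g h (suc n) = begin
    ((∂ f ⊛ g ⊕ f ⊛ ∂ g) ⊛ h) n + (f ⊛ g ⊛ ∂ h) n
      ≈⟨ +-congʳ (⊛-distribʳ h (∂ f ⊛ g) (f ⊛ ∂ g) n) ⟩
    ((∂ f ⊛ g ⊛ h) n + (f ⊛ ∂ g ⊛ h) n) + (f ⊛ g ⊛ ∂ h) n
      ≈⟨ +-cong (+-cong (⊛-assoc (∂ f) g h n) (⊛-assoc f (∂ g) h n)) (⊛-assoc f g (∂ h) n) ⟩
    ((∂ f ⊛ (g ⊛ h)) n + (f ⊛ (∂ g ⊛ h)) n) + (f ⊛ (g ⊛ ∂ h)) n
      ≈⟨ +-assoc _ _ _ ⟩
    (∂ f ⊛ (g ⊛ h)) n + ((f ⊛ (∂ g ⊛ h)) n + (f ⊛ (g ⊛ ∂ h)) n)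
      ≈⟨ +-congˡ (⊛-distribˡ f (∂ g ⊛ h) (g ⊛ ∂ h) n) ⟨
    (∂ f ⊛ (g ⊛ h)) n + (f ⊛ (∂ g ⊛ h ⊕ g ⊛ ∂ h)) n ∎

  ·-⊛ : ∀ a f g → (a · f) ⊛ g ≋ a · (f ⊛ g)
  ·-⊛ a f g zero    = *-assoc a (f 0) (g 0)
  ·-⊛ a f g (suc n) = trans (+-cong (·-⊛ a (∂ f) g n) (·-⊛ a f (∂ g) n)) (sym (distribˡ a _ _))

  ⊛-zeroˡ : ∀ f → 0ˢ ⊛ f ≋ 0ˢ
  ⊛-zeroˡ f zero    = zeroˡ (f 0)
  ⊛-zeroˡ f (suc n) = trans (+-cong (⊛-zeroˡ f n) (⊛-zeroˡ (∂ f) n)) (+-identityˡ 0#)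

  ⊛-identityˡ : ∀ f → 1ˢ ⊛ f ≋ f
  ⊛-identityˡ f zero    = *-identityˡ (f 0)
  ⊛-identityˡ f (suc n) = trans (+-cong (⊛-zeroˡ f n) (⊛-identityˡ (∂ f) n)) (+-identityˡ _)

  seriesRing : CommutativeRing c ℓ
  seriesRing = record
    { Carrier = Series ; _≈_ = _≋_ ; _+_ = _⊕_ ; _*_ = _⊛_ ; -_ = ⊝_ ; 0# = 0ˢ ; 1# = 1ˢ
    ; isCommutativeRing = record
      { isRing = record
        { +-isAbelianGroup = record
          { isGroup = record
            { isMonoid = record
              { isSemigroup = record
                { isMagma = record
                  { isEquivalence = record
                    { refl = λ _ → refl ; sym = λ e n → sym (e n) ; trans = λ d e n → trans (d n) (e n) }
                  ; ∙-cong = λ d e n → +-cong (d n) (e n) }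
                ; assoc = λ _ _ _ _ → +-assoc _ _ _ }
              ; identity = (λ _ _ → +-identityˡ _) , (λ _ _ → +-identityʳ _) }
            ; inverse = (λ _ _ → -‿inverseˡ _) , (λ _ _ → -‿inverseʳ _)
            ; ⁻¹-cong = λ e n → -‿cong (e n) }
          ; comm = λ _ _ _ → +-comm _ _ }
        ; *-cong = ⊛-cong
        ; *-assoc = ⊛-assoc
        ; *-identity = ⊛-identityˡ , (λ f n → trans (⊛-comm f 1ˢ n) (⊛-identityˡ f n))
        ; distrib = ⊛-distribˡ , ⊛-distribʳ }
      ; *-comm = ⊛-comm } }

  exp : Carrier → Series
  exp a n = a ^ n

  -- Both sides solve ∂ f = (a + b) f with constant term 1. In coefficients this is the binomial
  -- theorem, the binomial coefficients being hidden in `⊛`.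
  exp-⊛ : ∀ a b → exp a ⊛ exp b ≋ exp (a + b)
  exp-⊛ a b zero    = *-identityˡ 1#
  exp-⊛ a b (suc n) = begin
    ((a · exp a) ⊛ exp b) n + (exp a ⊛ (b · exp b)) n
      ≈⟨ +-cong (·-⊛ a (exp a) (exp b) n) (trans (⊛-comm (exp a) (b · exp b) n) (trans (·-⊛ b (exp b) (exp a) n) (*-congˡ (⊛-comm (exp b) (exp a) n)))) ⟩
    a * (exp a ⊛ exp b) n + b * (exp a ⊛ exp b) n
      ≈⟨ distribʳ _ a b ⟨
    (a + b) * (exp a ⊛ exp b) n
      ≈⟨ *-congˡ (exp-⊛ a b n) ⟩
    (a + b) * exp (a + b) n ∎

  exp-cong : ∀ {a b} → a ≈ b → exp a ≋ exp b
  exp-cong a≈b n = ^-congˡ n a≈b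

  exp-0# : exp 0# ≋ 1ˢ
  exp-0# zero    = refl
  exp-0# (suc n) = zeroˡ _

  private
    module Σ₀ = Sums R
    module Σˢ = Sums seriesRing

  ∑-eval : ∀ {a} {A : Set a} (xs : List A) f n → Σˢ.∑ xs f n ≡ Σ₀.∑ xs (λ x → f x n)
  ∑-eval []       f n = ≡.refl
  ∑-eval (x ∷ xs) f n = cong (f x n +_) (∑-eval xs f n)

  module Geometric (G : Series) (G₀≈0 : G 0 ≈ 0#) where

    -- Horner form of the partial sums 1 + G + ... + G^(k-1).
    neumann : ℕ → Series
    neumann zero    = 0ˢ
    neumann (suc k) = 1ˢ ⊕ G ⊛ neumann k

    private
      -- A factor without constant term raises the order of agreement by one: differentiating
      -- `H ⊛ f` leaves `∂ H ⊛ f`, which reads `f` only in the degrees of agreement, and `H ⊛ ∂ f`,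
      -- which is the same claim one degree lower.
      raise : ∀ k (H : Series) → H 0 ≈ 0# → ∀ {f g} → (∀ {n} → n ℕ.< k → f n ≈ g n) →
              ∀ {n} → n ℕ.≤ k → (H ⊛ f) n ≈ (H ⊛ g) n
      raise k H H₀ f≈g {zero} _ =
        trans (*-congʳ H₀) (trans (zeroˡ _) (sym (trans (*-congʳ H₀) (zeroˡ _))))
      raise (suc k) H H₀ f≈g {suc n} (ℕ.s≤s n≤k) = +-cong
        (⊛-cong≤ n {∂ H} (λ _ → refl) λ j≤n → f≈g (ℕ.s≤s (ℕ.≤-trans j≤n n≤k)))
        (raise k H H₀ (f≈g ∘ ℕ.s≤s) n≤k)

    neumann-stable : ∀ k {n} → n ℕ.< k → neumann k n ≈ neumann (suc k) n
    neumann-stable (suc k) {n} (ℕ.s≤s n≤k) = +-congˡ (raise k G G₀≈0 (neumann-stable k) n≤k)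

    -- The diagonal of the partial sums: Gᵏ with k > n does not reach degree `n`, so coefficient `n`
    -- is final from `neumann (suc n)` on.
    geometric : Series
    geometric n = neumann (suc n) n

    geometric-neumann : ∀ d n → neumann (d ℕ.+ suc n) n ≈ geometric n
    geometric-neumann zero    n = refl
    geometric-neumann (suc d) n =
      trans (sym (neumann-stable (d ℕ.+ suc n) (ℕ.m≤n+m (suc n) d))) (geometric-neumann d n)

    -- `geometric n` unfolds to `(1ˢ ⊕ G ⊛ neumann n) n`. There `raise` permits replacing
    -- `neumann n` by `geometric`, as the two agree below degree `n`.
    geometric-fixed : geometric ≋ 1ˢ ⊕ G ⊛ geometric
    geometric-fixed n = +-congˡ (raise n G G₀≈0 agree ℕ.≤-refl)
      where
        agree : ∀ {j} → j ℕ.< n → neumann n j ≈ geometric j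
        agree {j} j<n = ≡.subst (λ k → neumann k j ≈ geometric j) (ℕ.m∸n+n≡m j<n)
          (geometric-neumann (n ℕ.∸ suc j) j)

-- Derivatives of 1 / (1 - G) as sums over set partitions.

module Partitions {c ℓ} (R : CommutativeRing c ℓ) where
  open Series R
  open CommutativeRing seriesRing
  open SetoidReasoning setoid
  open NaturalCoefficients commutativeSemiring using (solve; _:=_; _:+_; _:*_; con)
  open SemiringExp semiring using (_^_)
  open SemiringMult semiring using (×-assoc-*; ×-congʳ; ×-assocˡ) renaming (_×_ to _•_)
  open Sums seriesRing
  private
    module R = CommutativeRing R
    module Mult = SemiringMult R.semiring
    module Σ₀ = Sums R

  ∂^ : ℕ → Series → Series
  ∂^ zero    f = f
  ∂^ (suc n) f = ∂ (∂^ n f)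

  ∂^-eval : ∀ n f k → ∂^ n f k ≡ f (n ℕ.+ k)
  ∂^-eval zero    f k = ≡.refl
  ∂^-eval (suc n) f k = ≡.trans (∂^-eval n f (suc k)) (cong f (ℕ.+-suc n k))

  ∂-cong : ∀ {f g} → f ≈ g → ∂ f ≈ ∂ g
  ∂-cong f≈g n = f≈g (suc n)

  ∂-∑ : ∀ {a} {A : Set a} (xs : List A) f → ∂ (∑ xs f) ≈ ∑ xs (∂ ∘ f)
  ∂-∑ []       f n = R.refl
  ∂-∑ (x ∷ xs) f n = R.+-congˡ (∂-∑ xs f n)

  ∂-• : ∀ n f → ∂ (n • f) ≈ n • ∂ f
  ∂-• zero    f k = R.refl
  ∂-• (suc n) f k = R.+-congˡ (∂-• n f k)

  •-eval : ∀ n f k → (n • f) k ≡ n Mult.× (f k)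
  •-eval zero    f k = ≡.refl
  •-eval (suc n) f k = cong (f k R.+_) (•-eval n f k)

  module _ (G M : Series) (M-fixed : M ≈ 1# + G * M) where

    1≈M-GM : 1# ≈ M * (1# + - G)
    1≈M-GM = begin
      1#                     ≈⟨ +-identityʳ 1# ⟨
      1# + 0#                ≈⟨ +-congˡ (-‿inverseʳ (G * M)) ⟨
      1# + (G * M + - (G * M)) ≈⟨ +-assoc _ _ _ ⟨
      1# + G * M + - (G * M)  ≈⟨ +-congʳ M-fixed ⟨
      M + - (G * M)          ≈⟨ +-cong (*-identityʳ M) (trans (*-comm M (- G)) (sym (-‿distribˡ-* G M))) ⟨
      M * 1# + M * - G       ≈⟨ distribˡ M 1# (- G) ⟨
      M * (1# + - G) ∎
      where open RingProperties ring using (-‿distribˡ-*)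

    -- Differentiating the fixed-point equation gives (1 - G) M′ = G′ M, and multiplication by `M`
    -- inverts 1 - G.
    ∂M : ∂ M ≈ ∂ G * (M * M)
    ∂M = begin
      ∂ M                             ≈⟨ *-identityˡ (∂ M) ⟨
      1# * ∂ M                        ≈⟨ *-congʳ 1≈M-GM ⟩
      M * (1# + - G) * ∂ M            ≈⟨ *-assoc M _ _ ⟩
      M * ((1# + - G) * ∂ M)          ≈⟨ *-congˡ (distribʳ (∂ M) 1# (- G)) ⟩
      M * (1# * ∂ M + - G * ∂ M)      ≈⟨ *-congˡ (+-congʳ (trans (*-identityˡ (∂ M)) ∂-fixed)) ⟩
      M * (∂ G * M + G * ∂ M + - G * ∂ M) ≈⟨ *-congˡ cancel ⟩
      M * (∂ G * M)                   ≈⟨ solve 2 (λ m g → m :* (g :* m) := g :* (m :* m)) refl M (∂ G) ⟩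
      ∂ G * (M * M) ∎
      where
        ∂-fixed : ∂ M ≈ ∂ G * M + G * ∂ M
        ∂-fixed n = R.trans (M-fixed (suc n)) (R.+-identityˡ _)
        cancel : ∂ G * M + G * ∂ M + - G * ∂ M ≈ ∂ G * M
        cancel = begin
          ∂ G * M + G * ∂ M + - G * ∂ M   ≈⟨ +-assoc _ _ _ ⟩
          ∂ G * M + (G * ∂ M + - G * ∂ M) ≈⟨ +-congˡ (distribʳ (∂ M) G (- G)) ⟨
          ∂ G * M + (G + - G) * ∂ M       ≈⟨ +-congˡ (*-congʳ (-‿inverseʳ G)) ⟩
          ∂ G * M + 0# * ∂ M              ≈⟨ +-congˡ (zeroˡ _) ⟩
          ∂ G * M + 0#                    ≈⟨ +-identityʳ _ ⟩
          ∂ G * M ∎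

    -- The power rule with M′ = G′ M² inserted: the exponent goes up by one, so that no M^(k-1) has
    -- to be written.
    ∂-M^ : ∀ k → ∂ (M ^ k) ≈ k • (M ^ suc k * ∂ G)
    ∂-M^ zero    n = R.refl
    ∂-M^ (suc k) = begin
      ∂ M * M ^ k + M * ∂ (M ^ k)
        ≈⟨ +-cong (*-congʳ ∂M) (*-congˡ (∂-M^ k)) ⟩
      ∂ G * (M * M) * M ^ k + M * (k • (M ^ suc k * ∂ G))
        ≈⟨ +-cong (solve 3 (λ g m r → g :* (m :* m) :* r := m :* (m :* r) :* g) refl (∂ G) M (M ^ k))
                  (trans (*-comm M _) (trans (×-assoc-* k _ M)
                    (×-congʳ k (solve 3 (λ r g m → r :* g :* m := m :* r :* g) refl (M ^ suc k) (∂ G) M)))) ⟩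
      suc k • (M ^ suc (suc k) * ∂ G) ∎

    private
      variable
        n : ℕ

    blocks : List (Subset n) → Series
    blocks π = foldr _*_ 1# (map (λ B → ∂^ ∣ B ∣ G) π)

    blocks-outside : ∀ (π : List (Subset n)) → blocks (map (outside ∷_) π) ≡ blocks π
    blocks-outside π = cong (foldr _*_ 1#) (≡.sym (map-∘ π))

    -- Leibniz' rule for a product of derivatives of G: zero joins a block where that factor is
    -- differentiated, and the new singleton block contributes the additional factor ∂ G.
    ∑-insertZero : ∀ (φ : ℕ → Series) (π : List (Subset n)) →
      ∑ (insertZero π) (λ ρ → φ (length ρ) * blocks ρ) ≈
      φ (length π) * ∂ (blocks π) + φ (suc (length π)) * ∂ G * blocks π
    ∑-insertZero {n} φ [] = begin
      φ 1 * (∂^ (suc ∣ ∅ {n} ∣) G * 1#) + 0#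
        ≡⟨ cong (λ b → φ 1 * (∂^ (suc b) G * 1#) + 0#) (∣⊥∣≡0 n) ⟩
      φ 1 * (∂ G * 1#) + 0#
        ≈⟨ solve 2 (λ f g → f :* (g :* con 1) :+ con 0 := f :* g :* con 1) (λ _ → R.refl) (φ 1) (∂ G) ⟩
      φ 1 * ∂ G * 1#
        ≈⟨ +-identityˡ _ ⟨
      0# + φ 1 * ∂ G * 1#
        ≈⟨ +-congʳ (zeroʳ (φ 0)) ⟨
      φ 0 * 0# + φ 1 * ∂ G * 1# ∎
    ∑-insertZero φ (B ∷ π) = begin
      φ (suc (length (map (outside ∷_) π))) * (∂ b * blocks (map (outside ∷_) π))
        + ∑ (map ((outside ∷ B) ∷_) (insertZero π)) (λ ρ → φ (length ρ) * blocks ρ)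
        ≡⟨ ≡.cong₂ _+_ (≡.cong₂ (λ k r → φ (suc k) * (∂ b * r)) (length-map _ π) (blocks-outside π))
                       (∑-map ((outside ∷ B) ∷_) (insertZero π) _) ⟩
      φ (suc k) * (∂ b * blocks π) + ∑ (insertZero π) (λ ρ → φ (suc (length ρ)) * (b * blocks ρ))
        ≈⟨ +-congˡ (∑-cong (insertZero π) λ _ → *-assoc _ _ _) ⟨
      φ (suc k) * (∂ b * blocks π) + ∑ (insertZero π) (λ ρ → φ (suc (length ρ)) * b * blocks ρ)
        -- The factor `b` of the first block is absorbed into the weight; for this reason `φ` is an
        -- arbitrary sequence of series.
        ≈⟨ +-congˡ (∑-insertZero (λ j → φ (suc j) * b) π) ⟩
      φ (suc k) * (∂ b * blocks π) + (φ (suc k) * b * ∂ (blocks π) + φ (suc (suc k)) * b * ∂ G * blocks π)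
        ≈⟨ solve 7 (λ f f′ b b′ p p′ g → f :* (b′ :* p) :+ (f :* b :* p′ :+ f′ :* b :* g :* p)
                                       := f :* (b′ :* p :+ b :* p′) :+ f′ :* g :* (b :* p))
             refl (φ (suc k)) (φ (suc (suc k))) b (∂ b) (blocks π) (∂ (blocks π)) (∂ G) ⟩
      φ (suc k) * (∂ b * blocks π + b * ∂ (blocks π)) + φ (suc (suc k)) * ∂ G * (b * blocks π) ∎
      where
        k = length π
        b = ∂^ ∣ B ∣ G

    -- The k-th derivative k! / (1 - u)^(k+1) of 1 / (1 - u), taken at u = G: the outer factor in
    -- Faà di Bruno's formula.
    weight : ℕ → Series
    weight k = (k !) • M ^ suc k

    ∂-weight : ∀ k → ∂ (weight k) ≈ weight (suc k) * ∂ G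
    ∂-weight k = begin
      ∂ ((k !) • M ^ suc k)                     ≈⟨ ∂-• (k !) (M ^ suc k) ⟩
      (k !) • ∂ (M ^ suc k)                     ≈⟨ ×-congʳ (k !) (∂-M^ (suc k)) ⟩
      (k !) • (suc k • (M ^ suc (suc k) * ∂ G)) ≈⟨ ×-assocˡ _ (k !) (suc k) ⟩
      (k ! ℕ.* suc k) • (M ^ suc (suc k) * ∂ G) ≡⟨ cong (_• (M ^ suc (suc k) * ∂ G)) (ℕ.*-comm (k !) (suc k)) ⟩
      (suc k !) • (M ^ suc (suc k) * ∂ G)       ≈⟨ ×-assoc-* (suc k !) _ _ ⟨
      weight (suc k) * ∂ G ∎

    -- Faà di Bruno's formula in its set-partition form. Passing from `n` to `suc n` works because
    -- `insertZero` lists exactly the terms that one differentiation produces from one partition.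
    ∂^-setPartitions : ∀ n → ∂^ n M ≈ ∑ (setPartitions n) (λ π → weight (length π) * blocks π)
    ∂^-setPartitions zero = solve 1 (λ m → m := (m :* con 1 :+ con 0) :* con 1 :+ con 0) (λ _ → R.refl) M
    ∂^-setPartitions (suc n) = begin
      ∂ (∂^ n M)
        ≈⟨ ∂-cong {∂^ n M} (∂^-setPartitions n) ⟩
      ∂ (∑ (setPartitions n) term)
        ≈⟨ ∂-∑ (setPartitions n) term ⟩
      ∑ (setPartitions n) (∂ ∘ term)
        ≈⟨ ∑-cong (setPartitions n) (λ {π} _ → ∂-term π) ⟩
      ∑ (setPartitions n) (λ π → ∑ (insertZero π) term)
        ≈⟨ ∑-concatMap insertZero (setPartitions n) term ⟨
      ∑ (setPartitions (suc n)) term ∎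
      where
        term : ∀ {n} → List (Subset n) → Series
        term π = weight (length π) * blocks π
        ∂-term : ∀ {n} (π : List (Subset n)) → ∂ (term π) ≈ ∑ (insertZero π) term
        ∂-term π = begin
          ∂ (weight (length π)) * blocks π + weight (length π) * ∂ (blocks π)
            ≈⟨ +-comm _ _ ⟩
          weight (length π) * ∂ (blocks π) + ∂ (weight (length π)) * blocks π
            ≈⟨ +-congˡ (*-congʳ (∂-weight (length π))) ⟩
          weight (length π) * ∂ (blocks π) + weight (suc (length π)) * ∂ G * blocks π
            ≈⟨ ∑-insertZero weight π ⟨
          ∑ (insertZero π) term ∎

    -- Constant coefficients are taken on both sides: `M 0 ≈ 1` removes the powers of `M`, and the
    -- b-th derivative of `G` contributes `G b`.
    geometric-setPartitions : ∀ n → M 0 R.≈ R.1# → M n R.≈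
      Σ₀.∑ (setPartitions n) (λ π → ((length π !) Mult.× R.1#) R.* foldr R._*_ R.1# (map (λ B → G ∣ B ∣) π))
    geometric-setPartitions n M₀≈1 =
      R.trans (R.reflexive (≡.sym (≡.trans (∂^-eval n M 0) (cong M (ℕ.+-identityʳ n)))))
      (R.trans (∂^-setPartitions n 0)
      (R.trans (R.reflexive (∑-eval (setPartitions n) _ 0))
        (Σ₀.∑-cong (setPartitions n) λ {π} _ → R.*-cong (weight₀ (length π)) (blocks₀ π))))
      where
        M^₀ : ∀ k → (M ^ k) 0 R.≈ R.1#
        M^₀ zero    = R.refl
        M^₀ (suc k) = R.trans (R.*-cong M₀≈1 (M^₀ k)) (R.*-identityˡ R.1#)
        weight₀ : ∀ k → weight k 0 R.≈ (k !) Mult.× R.1#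
        weight₀ k = R.trans (R.reflexive (•-eval (k !) _ 0)) (Mult.×-congʳ (k !) (M^₀ (suc k)))
        blocks₀ : ∀ {n} (π : List (Subset n)) → blocks π 0 R.≈ foldr R._*_ R.1# (map (λ B → G ∣ B ∣) π)
        blocks₀ []      = R.refl
        blocks₀ (B ∷ π) = R.*-cong
          (R.reflexive (≡.trans (∂^-eval ∣ B ∣ G 0) (cong G (ℕ.+-identityʳ ∣ B ∣)))) (blocks₀ π)

^-distribʳ-* : ∀ m n k → (m ℕ.* n) ℕ.^ k ≡ m ℕ.^ k ℕ.* n ℕ.^ k
^-distribʳ-* m n zero    = ≡.refl
^-distribʳ-* m n (suc k) = ≡.trans (cong (m ℕ.* n ℕ.*_) (^-distribʳ-* m n k))
  (ℕ.[m*n]*[o*p]≡[m*o]*[n*p] m n (m ℕ.^ k) (n ℕ.^ k))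

-- Ordered rings with null sequences.

-- What the argument uses of the reals: an ordered ring together with its null sequences.
record AsymptoticRing : Set₁ where
  infix 4 _≤_
  field
    commutativeRing : CommutativeRing 0ℓ 0ℓ
  open CommutativeRing commutativeRing public
  open SemiringMult semiring public using (×-homo-+; ×1-homo-*) renaming (_×_ to _•_)
  open SemiringExp semiring public using (_^_; ^-congˡ)

  ι : ℕ → Carrier
  ι n = n • 1#

  field
    _≤_         : Carrier → Carrier → Set
    ≤-reflexive : ∀ {x y} → x ≈ y → x ≤ y
    ≤-trans     : ∀ {x y z} → x ≤ y → y ≤ z → x ≤ z
    +-mono-≤    : ∀ {x y u v} → x ≤ y → u ≤ v → x + u ≤ y + v
    0≤1         : 0# ≤ 1#
    *-nonNeg    : ∀ {x y} → 0# ≤ x → 0# ≤ y → 0# ≤ x * y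
    Null         : (ℕ → Carrier) → Set
    null-cong    : ∀ {x y} → (∀ k → x k ≈ y k) → Null x → Null y
    null-+       : ∀ {x y} → Null x → Null y → Null (λ k → x k + y k)
    null-*ˡ      : ∀ {x} a → Null x → Null (λ k → a * x k)
    null-squeeze : ∀ {x y} → (∀ k → 0# ≤ x k) → (∀ k → x k ≤ y k) → Null y → Null x
    -- The Archimedean property enters here, in the form that a nonnegative sequence bounded by b /
    -- k is null.
    null-decay   : ∀ {x} b → (∀ k → 0# ≤ x k) → (∀ k → ι k * x k ≤ b) → Null x

  ≤-refl : ∀ {x} → x ≤ x
  ≤-refl = ≤-reflexive refl

  ≤-preorder : Preorder 0ℓ 0ℓ 0ℓ
  ≤-preorder = record { isPreorder = record
    { isEquivalence = isEquivalence ; reflexive = ≤-reflexive ; trans = ≤-trans } }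

  +-nonNeg : ∀ {x y} → 0# ≤ x → 0# ≤ y → 0# ≤ x + y
  +-nonNeg x≥0 y≥0 = ≤-trans (≤-reflexive (sym (+-identityˡ 0#))) (+-mono-≤ x≥0 y≥0)

  x≤x+y : ∀ {x y} → 0# ≤ y → x ≤ x + y
  x≤x+y y≥0 = ≤-trans (≤-reflexive (sym (+-identityʳ _))) (+-mono-≤ ≤-refl y≥0)

  y≤x+y : ∀ {x y} → 0# ≤ x → y ≤ x + y
  y≤x+y x≥0 = ≤-trans (≤-reflexive (sym (+-identityˡ _))) (+-mono-≤ x≥0 ≤-refl)

  *-monoʳ-≤ : ∀ {x y z} → 0# ≤ z → x ≤ y → z * x ≤ z * y
  *-monoʳ-≤ {x} {y} {z} z≥0 x≤y = begin
    z * x                   ≲⟨ y≤x+y (*-nonNeg z≥0 y-x≥0) ⟩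
    z * (y + - x) + z * x   ≈⟨ distribˡ z _ _ ⟨
    z * (y + - x + x)       ≈⟨ *-congˡ (trans (+-assoc _ _ _) (trans (+-congˡ (-‿inverseˡ x)) (+-identityʳ y))) ⟩
    z * y                   ∎
    where
      open PreorderReasoning ≤-preorder
      y-x≥0 : 0# ≤ y + - x
      y-x≥0 = ≤-trans (≤-reflexive (sym (-‿inverseʳ x))) (+-mono-≤ x≤y ≤-refl)

  *-mono-≤ : ∀ {x y u v} → 0# ≤ x → 0# ≤ v → x ≤ y → u ≤ v → x * u ≤ y * v
  *-mono-≤ x≥0 v≥0 x≤y u≤v = ≤-trans (*-monoʳ-≤ x≥0 u≤v)
    (≤-trans (≤-reflexive (*-comm _ _)) (≤-trans (*-monoʳ-≤ v≥0 x≤y) (≤-reflexive (*-comm _ _))))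

  ι-nonNeg : ∀ n → 0# ≤ ι n
  ι-nonNeg zero    = ≤-refl
  ι-nonNeg (suc n) = +-nonNeg 0≤1 (ι-nonNeg n)

  ι-mono : ∀ {m n} → m ℕ.≤ n → ι m ≤ ι n
  ι-mono {n = n} ℕ.z≤n = ι-nonNeg n
  ι-mono (ℕ.s≤s m≤n)   = +-mono-≤ ≤-refl (ι-mono m≤n)

  ι-^ : ∀ m n → ι (m ℕ.^ n) ≈ ι m ^ n
  ι-^ m zero    = +-identityʳ 1#
  ι-^ m (suc n) = trans (×1-homo-* m (m ℕ.^ n)) (*-congˡ (ι-^ m n))

  ^-nonNeg : ∀ {x} n → 0# ≤ x → 0# ≤ x ^ n
  ^-nonNeg zero    x≥0 = 0≤1
  ^-nonNeg (suc n) x≥0 = *-nonNeg x≥0 (^-nonNeg n x≥0)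

  null-0 : Null (λ _ → 0#)
  null-0 = null-decay 0# (λ _ → ≤-refl) (λ _ → ≤-reflexive (zeroʳ _))

  open Sums commutativeRing public

  ∑-mono-≤ : ∀ {A : Set} (xs : List A) {f g} → (∀ {x} → x ∈ xs → f x ≤ g x) → ∑ xs f ≤ ∑ xs g
  ∑-mono-≤ []       f≤g = ≤-refl
  ∑-mono-≤ (x ∷ xs) f≤g = +-mono-≤ (f≤g (here ≡.refl)) (∑-mono-≤ xs (f≤g ∘ there))

  ∑-nonNeg : ∀ {A : Set} (xs : List A) {f} → (∀ {x} → x ∈ xs → 0# ≤ f x) → 0# ≤ ∑ xs f
  ∑-nonNeg []       f≥0 = ≤-refl
  ∑-nonNeg (x ∷ xs) f≥0 = +-nonNeg (f≥0 (here ≡.refl)) (∑-nonNeg xs (f≥0 ∘ there))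

-- Coefficientwise asymptotic equality of sequences of series.

module Asymptotics (A : AsymptoticRing) where
  open AsymptoticRing A
  open Series commutativeRing
  open RingProperties ring using (-‿+-comm; -‿distribˡ-*; -‿distribʳ-*; -‿involutive)
  open SetoidReasoning setoid
  open NaturalCoefficients commutativeSemiring using (solve; _:=_; _:+_; _:*_)

  infix 4 _~_

  -- Relates two sequences of series without supposing that either converges; no uniformity in the
  -- degree `n` is asked for.
  _~_ : (ℕ → Series) → (ℕ → Series) → Set
  X ~ Y = ∀ n → Null (λ k → X k n - Y k n)

  ~-reflexive : ∀ {X Y} → (∀ k → X k ≋ Y k) → X ~ Y
  ~-reflexive {X} {Y} X≋Y n = null-cong
    (λ k → trans (sym (-‿inverseʳ (Y k n))) (+-congʳ (sym (X≋Y k n)))) null-0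

  ~-trans : ∀ {X Y Z} → X ~ Y → Y ~ Z → X ~ Z
  ~-trans {X} {Y} {Z} X~Y Y~Z n = null-cong (λ k → begin
    (X k n - Y k n) + (Y k n - Z k n) ≈⟨ solve 4 (λ x y′ y z → (x :+ y′) :+ (y :+ z) := (y′ :+ y) :+ (x :+ z)) refl _ _ _ _ ⟩
    (- Y k n + Y k n) + (X k n - Z k n) ≈⟨ +-congʳ (-‿inverseˡ _) ⟩
    0# + (X k n - Z k n) ≈⟨ +-identityˡ _ ⟩
    X k n - Z k n ∎) (null-+ (X~Y n) (Y~Z n))

  ~-⊕ : ∀ {X X′ Y Y′} → X ~ X′ → Y ~ Y′ → (λ k → X k ⊕ Y k) ~ (λ k → X′ k ⊕ Y′ k)
  ~-⊕ {X} {X′} {Y} {Y′} X~ Y~ n = null-cong (λ k → begin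
    (X k n - X′ k n) + (Y k n - Y′ k n) ≈⟨ solve 4 (λ x x′ y y′ → (x :+ x′) :+ (y :+ y′) := (x :+ y) :+ (x′ :+ y′)) refl _ _ _ _ ⟩
    (X k n + Y k n) + (- X′ k n - Y′ k n) ≈⟨ +-congˡ (-‿+-comm _ _) ⟩
    (X k n + Y k n) - (X′ k n + Y′ k n) ∎) (null-+ (X~ n) (Y~ n))

  ~-⊕-null : ∀ {X N : ℕ → Series} → (∀ n → Null (λ k → N k n)) → X ~ (λ k → X k ⊕ N k)
  ~-⊕-null {X} {N} null n = null-cong (λ k → begin
    - 1# * N k n                  ≈⟨ trans (sym (-‿distribˡ-* 1# _)) (-‿cong (*-identityˡ _)) ⟩
    - N k n                       ≈⟨ +-identityˡ _ ⟨
    0# - N k n                    ≈⟨ +-congʳ (-‿inverseʳ (X k n)) ⟨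
    (X k n - X k n) - N k n       ≈⟨ +-assoc _ _ _ ⟩
    X k n + (- X k n - N k n)     ≈⟨ +-congˡ (-‿+-comm _ _) ⟩
    X k n - (X k n + N k n)       ∎) (null-*ˡ (- 1#) (null n))

  ~-sym : ∀ {X Y} → X ~ Y → Y ~ X
  ~-sym {X} {Y} X~Y n = null-cong (λ k → begin
    - 1# * (X k n - Y k n)   ≈⟨ trans (sym (-‿distribˡ-* 1# _)) (-‿cong (*-identityˡ _)) ⟩
    - (X k n - Y k n)        ≈⟨ -‿+-comm _ _ ⟨
    - X k n - - Y k n        ≈⟨ +-comm _ _ ⟩
    - - Y k n - X k n        ≈⟨ +-congʳ (-‿involutive _) ⟩
    Y k n - X k n ∎) (null-*ˡ (- 1#) (X~Y n))

  -- By Leibniz' rule each coefficient of the product combines coefficients of `N k` with weights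
  -- taken from `g`. These weights are constant in `k`, so closure under sums and constant multiples
  -- suffices.
  null-⊛ : ∀ (N : ℕ → Series) g → (∀ n → Null (λ k → N k n)) → ∀ n → Null (λ k → (N k ⊛ g) n)
  null-⊛ N g null zero    = null-cong (λ k → *-comm (g 0) (N k 0)) (null-*ˡ (g 0) (null 0))
  null-⊛ N g null (suc n) = null-+ (null-⊛ (∂ ∘ N) g (null ∘ suc) n) (null-⊛ N (∂ g) null n)

  ~-⊛ : ∀ {X Y} g → X ~ Y → (λ k → X k ⊛ g) ~ (λ k → Y k ⊛ g)
  ~-⊛ {X} {Y} g X~Y n = null-cong
    (λ k → trans (⊛-distribʳ g (X k) (⊝ Y k) n) (+-congˡ (sym (S.-‿distribˡ-* (Y k) g n))))
    (null-⊛ (λ k → X k ⊕ ⊝ Y k) g X~Y n)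
    where module S = RingProperties (CommutativeRing.ring seriesRing)

  ~-· : ∀ {X Y} a → X ~ Y → (λ k → a · X k) ~ (λ k → a · Y k)
  ~-· {X} {Y} a X~Y n = null-cong
    (λ k → trans (distribˡ a _ _) (+-congˡ (sym (-‿distribʳ-* a _)))) (null-*ˡ a (X~Y n))

  ~-∑ : ∀ {I : Set} (xs : List I) {X Y : I → ℕ → Series} → (∀ {x} → x ∈ xs → X x ~ Y x) →
        (λ k n → ∑ xs (λ x → X x k n)) ~ (λ k n → ∑ xs (λ x → Y x k n))
  ~-∑ []       X~Y = ~-reflexive (λ _ _ → refl)
  ~-∑ (x ∷ xs) X~Y = ~-⊕ (X~Y (here ≡.refl)) (~-∑ xs (X~Y ∘ there))

-- The renewal equation and the limit of the truncated moments.

-- a k and t k play the roles of P(Y = k) and P(Y > k), c and r those of 1 / P(R) and |R|.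
module _ (A : AsymptoticRing) where
  open AsymptoticRing A

  module Renewal {I : Set} (os : List I)
    (c : I → Carrier) (r : I → ℕ) (a t : ℕ → Carrier)
    (c≥0 : ∀ {o} → o ∈ os → 0# ≤ c o) (r≥1 : ∀ {o} → o ∈ os → 1 ℕ.≤ r o)
    (a≥0 : ∀ k → 0# ≤ a k) (t≥0 : ∀ k → 0# ≤ t k)
    (a₀ : a 0 ≈ 0#) (a-early : ∀ {o j} → o ∈ os → j ℕ.< r o → a j ≈ 0#) (t₀ : t 0 ≈ 1#)
    (t-step : ∀ k → t k ≈ a (suc k) + t (suc k))
    (renewal : ∀ k → t k ≈ ∑ os (λ o → c o * a (k ℕ.+ r o)))
    where
    open Series commutativeRing
    open Asymptotics A
    open NaturalCoefficients commutativeSemiring using (solve; _:=_; _:+_; _:*_; con)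
    open PreorderReasoning ≤-preorder
    private module S = CommutativeRing seriesRing

    t-anti : ∀ i j → t (i ℕ.+ j) ≤ t j
    t-anti zero    j = ≤-refl
    t-anti (suc i) j = begin
      t (suc i ℕ.+ j)                        ≲⟨ y≤x+y (a≥0 _) ⟩
      a (suc i ℕ.+ j) + t (suc i ℕ.+ j)      ≈⟨ t-step (i ℕ.+ j) ⟨
      t (i ℕ.+ j)                            ≲⟨ t-anti i j ⟩
      t j                                    ∎

    a≤t : ∀ i j → a (i ℕ.+ suc j) ≤ t j
    a≤t i j = begin
      a (i ℕ.+ suc j)                             ≡⟨ cong a (ℕ.+-suc i j) ⟩
      a (suc (i ℕ.+ j))                           ≲⟨ x≤x+y (t≥0 _) ⟩
      a (suc (i ℕ.+ j)) + t (suc (i ℕ.+ j))       ≈⟨ t-step (i ℕ.+ j) ⟨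
      t (i ℕ.+ j)                                 ≲⟨ t-anti i j ⟩
      t j                                         ∎

    -- A discrete potential of t: its decrements are the values of t, and it is at most mean * t.
    potential : ℕ → Carrier
    potential k = ∑ os (λ o → c o * t (ℕ.pred (r o) ℕ.+ k))

    -- In the application this is Σ 1 / P(R), the value of E(Y): for n = 1 the numerators (1 - |R|)
    -- - (-|R|) all equal 1.
    mean : Carrier
    mean = ∑ os c

    mean≥0 : 0# ≤ mean
    mean≥0 = ∑-nonNeg os c≥0

    shift-r : ∀ {o} → o ∈ os → ∀ k → suc (ℕ.pred (r o) ℕ.+ k) ≡ k ℕ.+ r o
    shift-r {o} o∈ k with r o | r≥1 o∈
    ... | suc s | _ = ℕ.+-comm (suc s) k

    -- By `t-step`, `a (k + r o)` is the drop of `t` from time k + r - 1 to k + r. The renewal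
    -- equation adds these drops up to `t k`.
    potential-step : ∀ k → t k + potential (suc k) ≈ potential k
    potential-step k = begin-equality
      t k + potential (suc k)
        ≈⟨ +-congʳ (renewal k) ⟩
      ∑ os (λ o → c o * a (k ℕ.+ r o)) + potential (suc k)
        ≈⟨ ∑-+ os _ _ ⟨
      ∑ os (λ o → c o * a (k ℕ.+ r o) + c o * t (ℕ.pred (r o) ℕ.+ suc k))
        ≈⟨ ∑-cong os (λ {o} o∈ → begin-equality
             c o * a (k ℕ.+ r o) + c o * t (ℕ.pred (r o) ℕ.+ suc k)
               ≡⟨ ≡.cong₂ (λ i j → c o * a i + c o * t j) (≡.sym (shift-r o∈ k)) (ℕ.+-suc (ℕ.pred (r o)) k) ⟩
             c o * a (suc (ℕ.pred (r o) ℕ.+ k)) + c o * t (suc (ℕ.pred (r o) ℕ.+ k))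
               ≈⟨ distribˡ (c o) _ _ ⟨
             c o * (a (suc (ℕ.pred (r o) ℕ.+ k)) + t (suc (ℕ.pred (r o) ℕ.+ k)))
               ≈⟨ *-congˡ (t-step _) ⟨
             c o * t (ℕ.pred (r o) ℕ.+ k) ∎) ⟩
      potential k ∎

    potential≥0 : ∀ k → 0# ≤ potential k
    potential≥0 k = ∑-nonNeg os (λ o∈ → *-nonNeg (c≥0 o∈) (t≥0 _))

    potential≤ : ∀ k → potential k ≤ mean * t k
    potential≤ k = begin
      potential k                  ≲⟨ ∑-mono-≤ os (λ {o} o∈ → *-monoʳ-≤ (c≥0 o∈) (t-anti (ℕ.pred (r o)) k)) ⟩
      ∑ os (λ o → c o * t k)       ≈⟨ ∑-*ʳ os (t k) c ⟩
      mean * t k ∎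

    -- Add up `potential-step` over the `suc j` times from `i` to `j + i`, and replace every value
    -- of `t` by the last and smallest one.
    t-window : ∀ i j → ι (suc j) * t (j ℕ.+ i) + potential (suc (j ℕ.+ i)) ≤ potential i
    t-window i zero = ≤-reflexive (trans
      (+-congʳ (trans (*-congʳ (+-identityʳ 1#)) (*-identityˡ _))) (potential-step i))
    t-window i (suc j) = begin
      (1# + ι (suc j)) * t k′ + potential (suc k′)
        ≈⟨ solve 3 (λ n x y → (con 1 :+ n) :* x :+ y := n :* x :+ (x :+ y)) refl (ι (suc j)) (t k′) (potential (suc k′)) ⟩
      ι (suc j) * t k′ + (t k′ + potential (suc k′))
        ≈⟨ +-congˡ (potential-step k′) ⟩
      ι (suc j) * t k′ + potential k′
        ≲⟨ +-mono-≤ (*-monoʳ-≤ (ι-nonNeg (suc j)) (t-anti 1 (j ℕ.+ i))) ≤-refl ⟩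
      ι (suc j) * t (j ℕ.+ i) + potential k′
        ≲⟨ t-window i j ⟩
      potential i ∎
      where k′ = suc (j ℕ.+ i)

    t-decay : ∀ i j → ι (suc j) * t (j ℕ.+ i) ≤ mean * t i
    t-decay i j = ≤-trans (x≤x+y (potential≥0 _)) (≤-trans (t-window i j) (potential≤ i))

    -- `t-decay` chained over `k` consecutive windows of length `j`, starting from `t 0 ≈ 1`; each
    -- window gains a factor `mean` / (j + 1).
    t-decay-^ : ∀ j k → ι (suc j ℕ.^ k) * t (k ℕ.* j) ≤ mean ^ k
    t-decay-^ j zero    = ≤-reflexive (trans (*-cong (+-identityʳ 1#) t₀) (*-identityˡ 1#))
    t-decay-^ j (suc k) = begin
      ι (suc j ℕ.* suc j ℕ.^ k) * t (j ℕ.+ k ℕ.* j)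
        ≈⟨ *-congʳ (×1-homo-* (suc j) (suc j ℕ.^ k)) ⟩
      ι (suc j) * ι (suc j ℕ.^ k) * t (j ℕ.+ k ℕ.* j)
        ≈⟨ solve 3 (λ x y z → x :* y :* z := y :* (x :* z)) refl _ _ _ ⟩
      ι (suc j ℕ.^ k) * (ι (suc j) * t (j ℕ.+ k ℕ.* j))
        ≲⟨ *-monoʳ-≤ (ι-nonNeg (suc j ℕ.^ k)) (t-decay (k ℕ.* j) j) ⟩
      ι (suc j ℕ.^ k) * (mean * t (k ℕ.* j))
        ≈⟨ solve 3 (λ x y z → y :* (x :* z) := x :* (y :* z)) refl _ _ _ ⟩
      mean * (ι (suc j ℕ.^ k) * t (k ℕ.* j))
        ≲⟨ *-monoʳ-≤ mean≥0 (t-decay-^ j k) ⟩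
      mean * mean ^ k ∎

    e : ℕ → Series
    e k = exp (ι k)

    -- Splitting k steps into n + 1 windows of length j ≈ k / (n + 1), each costing a factor mean / (j + 1).
    t-moment-bound : ∀ n k → ι k * (t k * e k n) ≤ ι (suc n ℕ.^ suc n) * mean ^ suc n
    t-moment-bound n k = begin
      ι k * (t k * ι k ^ n)
        ≈⟨ solve 3 (λ x y z → x :* (y :* z) := x :* z :* y) refl _ _ _ ⟩
      ι k ^ d * t k
        ≈⟨ *-congʳ (ι-^ k d) ⟨
      ι (k ℕ.^ d) * t k
        ≲⟨ *-mono-≤ (ι-nonNeg (k ℕ.^ d)) (t≥0 _) (ι-mono k^d≤) t≤ ⟩
      ι (d ℕ.^ d ℕ.* suc j ℕ.^ d) * t (d ℕ.* j)
        ≈⟨ trans (*-congʳ (×1-homo-* (d ℕ.^ d) (suc j ℕ.^ d))) (*-assoc _ _ _) ⟩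
      ι (d ℕ.^ d) * (ι (suc j ℕ.^ d) * t (d ℕ.* j))
        ≲⟨ *-monoʳ-≤ (ι-nonNeg (d ℕ.^ d)) (t-decay-^ j d) ⟩
      ι (d ℕ.^ d) * mean ^ d ∎
      where
        -- One window more than the order of the moment: the spare power of `k` is the factor `ι k`
        -- that `null-decay` requires.
        d = suc n
        -- Rounding down serves both estimates: d j ≤ k bounds `t k` by `t (d * j)`, and k ≤ d (j +
        -- 1) lets the powers of j + 1 pay for those of k.
        j = k ℕ./ d
        k≡ : k ≡ k ℕ.% d ℕ.+ d ℕ.* j
        k≡ = ≡.trans (ℕ.m≡m%n+[m/n]*n k d) (cong (k ℕ.% d ℕ.+_) (ℕ.*-comm j d))
        t≤ : t k ≤ t (d ℕ.* j)
        t≤ = ≡.subst (λ i → t i ≤ t (d ℕ.* j)) (≡.sym k≡) (t-anti (k ℕ.% d) (d ℕ.* j))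
        k≤ : k ℕ.≤ d ℕ.* suc j
        k≤ = ≡.subst₂ ℕ._≤_ (≡.sym k≡) (≡.sym (ℕ.*-suc d j)) (ℕ.+-monoˡ-≤ (d ℕ.* j) (ℕ.<⇒≤ (ℕ.m%n<n k d)))
        k^d≤ : k ℕ.^ d ℕ.≤ d ℕ.^ d ℕ.* suc j ℕ.^ d
        k^d≤ = ≡.subst (k ℕ.^ d ℕ.≤_) (^-distribʳ-* d (suc j) d) (ℕ.^-monoˡ-≤ d k≤)

    e≥0 : ∀ k n → 0# ≤ e k n
    e≥0 k n = ^-nonNeg n (ι-nonNeg k)

    t-null : ∀ n → Null (λ k → t k * e k n)
    t-null n = null-decay _ (λ k → *-nonNeg (t≥0 k) (e≥0 k n)) (t-moment-bound n)

    -- `a≤t` bounds the mass by `t k`, but the weight belongs to the later time `i + suc k`. The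
    -- exponential law splits off the fixed factor `e (suc i)` and leaves the weight of time `k`.
    a-null : ∀ i n → Null (λ k → a (i ℕ.+ suc k) * e (i ℕ.+ suc k) n)
    a-null i n = null-cong
      (λ k → trans (·-⊛ (a (i ℕ.+ suc k)) (e k) (e (suc i)) n)
        (*-congˡ (trans (exp-⊛ (ι k) (ι (suc i)) n) (exp-cong (e-shift k) n))))
      (null-⊛ (λ k → a (i ℕ.+ suc k) · e k) (e (suc i))
        (λ j → null-squeeze (λ k → *-nonNeg (a≥0 _) (e≥0 k j))
          (λ k → *-mono-≤ (a≥0 _) (e≥0 k j) (a≤t i k) ≤-refl) (t-null j)) n)
      where
        e-shift : ∀ k → ι k + ι (suc i) ≈ ι (i ℕ.+ suc k)
        e-shift k = trans (sym (×-homo-+ 1# k (suc i)))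
          (reflexive (cong ι (≡.trans (ℕ.+-comm k (suc i)) (≡.sym (ℕ.+-suc i k)))))

    moments : ℕ → Series
    moments k n = ∑< k (λ j → a j * e j n)

    moments-shift : ∀ i → (λ k → moments (suc k)) ~ (λ k → moments (i ℕ.+ suc k))
    moments-shift zero    = ~-reflexive (λ _ _ → refl)
    moments-shift (suc i) = ~-trans (moments-shift i) (~-⊕-null (a-null i))

    kernel : I → Series
    kernel o = exp (1# - ι (r o)) ⊕ ⊝ exp (- ι (r o))

    G : Series
    G n = ∑ os (λ o → c o * kernel o n)

    -- Multiplication by exp(-r) moves a weight back by r steps. Thus the mass `a (k + r o)`
    -- receives just the increment that summation by parts attaches to `t k`.
    kernel-⊛-e : ∀ o k → kernel o ⊛ e (k ℕ.+ r o) ≋ e (suc k) ⊕ ⊝ e k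
    kernel-⊛-e o k n = begin-equality
      (kernel o ⊛ e (k ℕ.+ r o)) n
        ≈⟨ ⊛-distribʳ (e (k ℕ.+ r o)) (exp (1# - ι (r o))) (⊝ exp (- ι (r o))) n ⟩
      (exp (1# - ι (r o)) ⊛ e (k ℕ.+ r o)) n + ((⊝ exp (- ι (r o))) ⊛ e (k ℕ.+ r o)) n
        ≈⟨ +-congˡ (SP.-‿distribˡ-* (exp (- ι (r o))) (e (k ℕ.+ r o)) n) ⟨
      (exp (1# - ι (r o)) ⊛ e (k ℕ.+ r o)) n - (exp (- ι (r o)) ⊛ e (k ℕ.+ r o)) n
        ≈⟨ +-cong (trans (exp-⊛ _ _ n) (exp-cong (trans (+-assoc _ _ _) (+-congˡ cancel)) n))
                  (-‿cong (trans (exp-⊛ _ _ n) (exp-cong cancel n))) ⟩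
      e (suc k) n - e k n ∎
      where
        module SP = RingProperties S.ring
        cancel : - ι (r o) + ι (k ℕ.+ r o) ≈ ι k
        cancel = begin-equality
          - ι (r o) + ι (k ℕ.+ r o)     ≈⟨ +-congˡ (×-homo-+ 1# k (r o)) ⟩
          - ι (r o) + (ι k + ι (r o))   ≈⟨ solve 3 (λ x y z → x :+ (y :+ z) := y :+ (x :+ z)) refl _ _ _ ⟩
          ι k + (- ι (r o) + ι (r o))   ≈⟨ +-congˡ (-‿inverseˡ _) ⟩
          ι k + 0#                      ≈⟨ +-identityʳ _ ⟩
          ι k ∎

    ∑<-zero : ∀ k {x} → (∀ {j} → j ℕ.< k → x j ≈ 0#) → ∑< k x ≈ 0#
    ∑<-zero zero    x≈0 = refl
    ∑<-zero (suc k) x≈0 = trans (+-cong (∑<-zero k (x≈0 ∘ ℕ.m≤n⇒m≤1+n)) (x≈0 ℕ.≤-refl)) (+-identityˡ 0#)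

    -- Summation by parts of Σ_{i<k} t i · (e (i + 1) − e i), with t i replaced by the renewal equation.
    moments-renewal : ∀ k n → moments (suc k) n + t k * e k n ≈
      1ˢ n + ∑ os (λ o → c o * (kernel o ⊛ moments (k ℕ.+ r o)) n)
    moments-renewal zero n = begin-equality
      0# + a 0 * e 0 n + t 0 * e 0 n
        ≈⟨ +-cong (trans (+-identityˡ _) (trans (*-congʳ a₀) (zeroˡ _)))
                  (trans (*-cong t₀ (exp-0# n)) (*-identityˡ _)) ⟩
      0# + 1ˢ n
        ≈⟨ +-comm _ _ ⟩
      1ˢ n + 0#
        -- The sums on the right already run over times below `r o`, but `a-early` makes all their
        -- terms vanish.
        ≈⟨ +-congˡ (∑-zero os λ {o} o∈ → trans (*-congˡ (trans
             (⊛-cong {kernel o} (λ _ → refl) (λ j → ∑<-zero (r o) λ i<r →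
               trans (*-congʳ (a-early o∈ i<r)) (zeroˡ _)) n)
             (trans (⊛-comm (kernel o) 0ˢ n) (⊛-zeroˡ (kernel o) n)))) (zeroʳ _)) ⟨
      1ˢ n + ∑ os (λ o → c o * (kernel o ⊛ moments (r o)) n) ∎
    moments-renewal (suc k) n = begin-equality
      moments (suc k) n + a (suc k) * e (suc k) n + t (suc k) * e (suc k) n
        ≈⟨ solve 4 (λ m x y z → m :+ x :* z :+ y :* z := m :+ (x :+ y) :* z) refl _ _ _ _ ⟩
      moments (suc k) n + (a (suc k) + t (suc k)) * e (suc k) n
        ≈⟨ +-congˡ (*-congʳ (t-step k)) ⟨
      moments (suc k) n + t k * e (suc k) n
        ≈⟨ +-congˡ (*-congˡ split) ⟩
      moments (suc k) n + t k * (e k n + (e (suc k) n - e k n))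
        ≈⟨ solve 4 (λ m x y z → m :+ x :* (y :+ z) := (m :+ x :* y) :+ x :* z) refl _ _ _ _ ⟩
      (moments (suc k) n + t k * e k n) + t k * (e (suc k) n - e k n)
        ≈⟨ +-cong (moments-renewal k n) (trans (*-congʳ (renewal k)) (sym (∑-*ʳ os _ _))) ⟩
      (1ˢ n + ∑ os (λ o → c o * (kernel o ⊛ moments (k ℕ.+ r o)) n))
        + ∑ os (λ o → c o * a (k ℕ.+ r o) * (e (suc k) n - e k n))
        ≈⟨ trans (+-assoc _ _ _) (+-congˡ (sym (∑-+ os _ _))) ⟩
      1ˢ n + ∑ os (λ o → c o * (kernel o ⊛ moments (k ℕ.+ r o)) n + c o * a (k ℕ.+ r o) * (e (suc k) n - e k n))
        ≈⟨ +-congˡ (∑-cong os λ {o} _ → sym (step o)) ⟩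
      1ˢ n + ∑ os (λ o → c o * (kernel o ⊛ moments (suc k ℕ.+ r o)) n) ∎
      where
        split : e (suc k) n ≈ e k n + (e (suc k) n - e k n)
        split = sym (trans (solve 3 (λ x y z → x :+ (y :+ z) := y :+ (x :+ z)) refl _ _ _)
          (trans (+-congˡ (-‿inverseʳ _)) (+-identityʳ _)))
        step : ∀ o → c o * (kernel o ⊛ moments (suc k ℕ.+ r o)) n ≈
          c o * (kernel o ⊛ moments (k ℕ.+ r o)) n + c o * a (k ℕ.+ r o) * (e (suc k) n - e k n)
        step o = begin-equality
          c o * (kernel o ⊛ (moments k′ ⊕ a k′ · e k′)) n
            ≈⟨ *-congˡ (⊛-distribˡ (kernel o) (moments k′) (a k′ · e k′) n) ⟩
          c o * ((kernel o ⊛ moments k′) n + (kernel o ⊛ (a k′ · e k′)) n)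
            ≈⟨ *-congˡ (+-congˡ (trans (⊛-comm (kernel o) (a k′ · e k′) n)
                 (trans (·-⊛ (a k′) (e k′) (kernel o) n) (*-congˡ (trans (⊛-comm (e k′) (kernel o) n) (kernel-⊛-e o k n)))))) ⟩
          c o * ((kernel o ⊛ moments k′) n + a k′ * (e (suc k) n - e k n))
            ≈⟨ solve 4 (λ x y z w → x :* (y :+ z :* w) := x :* y :+ x :* z :* w) refl _ _ _ _ ⟩
          c o * (kernel o ⊛ moments k′) n + c o * a k′ * (e (suc k) n - e k n) ∎
          where k′ = k ℕ.+ r o

    G-⊛ : ∀ f n → ∑ os (λ o → c o * (kernel o ⊛ f) n) ≈ (G ⊛ f) n
    G-⊛ f n = go os
      where
        go : ∀ xs → ∑ xs (λ o → c o * (kernel o ⊛ f) n) ≈ ((λ j → ∑ xs (λ o → c o * kernel o j)) ⊛ f) n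
        go []       = sym (⊛-zeroˡ f n)
        go (o ∷ xs) = trans (+-cong (sym (·-⊛ (c o) (kernel o) f n)) (go xs))
          (sym (⊛-distribʳ f (c o · kernel o) (λ j → ∑ xs (λ o → c o * kernel o j)) n))

    G₀ : G 0 ≈ 0#
    G₀ = ∑-zero os (λ _ → trans (*-congˡ (-‿inverseʳ 1#)) (zeroʳ _))

    open Geometric G G₀
    open Partitions commutativeRing

    -- In `moments-renewal` each `o` has its own cutoff `k + r o`. `moments-shift` moves all of them
    -- to `suc k`, and `t-null` discards the boundary term `t k * e k n`.
    moments-fixed : (λ k → moments (suc k)) ~ (λ k → 1ˢ ⊕ G ⊛ moments (suc k))
    moments-fixed = ~-trans (~-⊕-null t-null)
      (~-trans (~-reflexive moments-renewal)
      (~-trans (~-⊕ (~-reflexive (λ _ _ → refl)) (~-∑ os λ {o} o∈ → ~-· (c o)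
          (~-trans (~-reflexive (λ k → ⊛-comm (kernel o) (moments (k ℕ.+ r o))))
          (~-trans (~-⊛ (kernel o) (~-trans
              (~-reflexive λ k n → reflexive (cong (λ i → moments i n) (≡.trans (≡.sym (shift-r o∈ k)) (≡.sym (ℕ.+-suc (ℕ.pred (r o)) k)))))
              (~-sym (moments-shift (ℕ.pred (r o))))))
            (~-reflexive (λ k → ⊛-comm (moments (suc k)) (kernel o)))))))
        (~-reflexive λ k n → +-congˡ (G-⊛ (moments (suc k)) n))))

    -- For every series X, `cancel` says exactly that (X - G X) ⊛ `geometric` is X. As X - G X is
    -- asymptotically 1 for the truncated moments, multiplying by the fixed series `geometric`
    -- yields the limit.
    moments-limit : (λ k → moments (suc k)) ~ (λ _ → geometric)
    moments-limit = ~-trans (~-reflexive λ k → S.sym (cancel (moments (suc k))))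
      (~-trans (~-⊛ geometric difference) (~-reflexive λ _ → ⊛-identityˡ geometric))
      where
        module SR = SetoidReasoning S.setoid
        open RingProperties S.ring using () renaming (-‿distribˡ-* to ⊝-distribˡ-⊛)
        cancel : ∀ X → (X ⊕ ⊝ (G ⊛ X)) ⊛ geometric ≋ X
        cancel X = SR.begin
          (X ⊕ ⊝ (G ⊛ X)) ⊛ geometric
            SR.≈⟨ S.*-congʳ (S.+-cong (S.sym (S.*-identityʳ X)) (S.trans (⊝-distribˡ-⊛ G X) (S.*-comm (⊝ G) X))) ⟩
          (X ⊛ 1ˢ ⊕ X ⊛ (⊝ G)) ⊛ geometric
            SR.≈⟨ S.*-congʳ (S.sym (S.distribˡ X 1ˢ (⊝ G))) ⟩
          X ⊛ (1ˢ ⊕ ⊝ G) ⊛ geometric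
            SR.≈⟨ S.trans (S.*-assoc X _ geometric) (S.*-congˡ (S.*-comm (1ˢ ⊕ ⊝ G) geometric)) ⟩
          X ⊛ (geometric ⊛ (1ˢ ⊕ ⊝ G))
            SR.≈⟨ S.*-congˡ (S.sym (1≈M-GM G geometric geometric-fixed)) ⟩
          X ⊛ 1ˢ
            SR.≈⟨ S.*-identityʳ X ⟩
          X SR.∎
        difference : (λ k → moments (suc k) ⊕ ⊝ (G ⊛ moments (suc k))) ~ (λ _ → 1ˢ)
        difference = ~-trans (~-⊕ moments-fixed (~-reflexive (λ _ _ → refl)))
          (~-reflexive λ k → S.trans (S.+-assoc 1ˢ _ _)
            (S.trans (S.+-congˡ (S.-‿inverseʳ (G ⊛ moments (suc k)))) (S.+-identityʳ 1ˢ)))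

    geometric₀ : geometric 0 ≈ 1#
    geometric₀ = trans (+-congˡ (zeroʳ _)) (+-identityʳ 1#)

    moments-setPartitions : ∀ n → Null (λ k → moments (suc k) n -
      ∑ (setPartitions n) (λ π → ι (length π !) * foldr _*_ 1# (map (λ B → G ∣ B ∣) π)))
    moments-setPartitions n = null-cong
      (λ k → +-congˡ (-‿cong (geometric-setPartitions G geometric geometric-fixed n geometric₀)))
      (moments-limit n)

-- Prefixes, suffixes and first occurrences of a word.

module _ {A : Set} where

  take-++ : ∀ (xs ys : List A) {j} → j ℕ.≤ length xs → take j (xs ++ ys) ≡ take j xs
  take-++ xs       ys {zero}  _          = ≡.refl
  take-++ (x ∷ xs) ys {suc j} (s≤s j≤xs) = cong (x ∷_) (take-++ xs ys j≤xs)

  suffix-comparable : ∀ {u v w : List A} → Suffix _≡_ u w → Suffix _≡_ v w → length u ℕ.≤ length v → Suffix _≡_ u v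
  suffix-comparable u⊑w         (here v≋w)  u≤v with ≡.refl ← Pointwise-≡⇒≡ v≋w = u⊑w
  suffix-comparable (here u≋w)  (there v⊑w) u≤v =
    ⊥-elim (ℕ.<-irrefl ≡.refl (ℕ.≤-trans (s≤s (ℕ.≤-trans u≤v (Suffix.length-mono v⊑w))) (ℕ.≤-reflexive (≡.sym (Pointwise-length u≋w)))))
  suffix-comparable (there u⊑w) (there v⊑w) u≤v = suffix-comparable u⊑w v⊑w u≤v

  suffix-unique : ∀ {u v w : List A} → Suffix _≡_ u w → Suffix _≡_ v w → length u ≡ length v → u ≡ v
  suffix-unique u⊑w v⊑w eq =
    Pointwise-≡⇒≡ (Suffix.toPointwise eq (suffix-comparable u⊑w v⊑w (ℕ.≤-reflexive eq)))

  prefixes : List A → List (List A)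
  prefixes = drop 1 ∘ inits

  ∈-inits⇒prefix : ∀ (xs : List A) {ys} → ys ∈ inits xs → Prefix _≡_ ys xs
  ∈-inits⇒prefix xs       (here ≡.refl) = []
  ∈-inits⇒prefix (x ∷ xs) (there ys∈) with _ , zs∈ , ≡.refl ← ∈-map⁻ (x ∷_) {xs = inits xs} ys∈ =
    ≡.refl ∷ ∈-inits⇒prefix xs zs∈

  ∈-prefixes⇒nonempty : ∀ (xs : List A) {ys} → ys ∈ prefixes xs → ys ≢ []
  ∈-prefixes⇒nonempty (x ∷ xs) ys∈ with _ , _ , ≡.refl ← ∈-map⁻ (x ∷_) {xs = inits xs} ys∈ = λ ()

module Occurrences {m : ℕ} (S : Word m) where

  Occurs : Word m → Set
  Occurs = Infix _≡_ S

  FirstAt : ℕ → Word m → Set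
  FirstAt k w = Occurs w × (∀ {j} → j ℕ.< k → ¬ Occurs (take j w))

  First : Word m → Set
  First w = FirstAt (length w) w

  first? : ∀ w → Dec (First w)
  first? w = base? (equals (waitingTime S) (length w)) w

  occurs-last : ∀ u → Occurs (u ++ S)
  occurs-last u = u ++ⁱ Infix.fromPointwise (Pointwise.refl ≡.refl)

  -- A letter `i` behind the occurrence found would leave `u ++ S` as a proper prefix that already
  -- contains `S`.
  first⇒suffix : ∀ {w} → First w → Suffix _≡_ S w
  first⇒suffix (s , first) with MkView u pw v ← Infix.toView s with ≡.refl ← Pointwise-≡⇒≡ pw | v
  ... | []    = ≡.subst (Suffix _≡_ S) (cong (u ++_) (≡.sym (++-identityʳ S))) (u ++ˢ here (Pointwise.refl ≡.refl))
  ... | i ∷ v = ⊥-elim (first {length (u ++ S)} shorter (≡.subst Occurs (≡.sym front) (occurs-last u)))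
    where
      regroup : u ++ S ++ i ∷ v ≡ (u ++ S) ++ i ∷ v
      regroup = ≡.sym (++-assoc u S (i ∷ v))
      shorter : length (u ++ S) ℕ.< length (u ++ S ++ i ∷ v)
      shorter = ≡.subst (λ w → length (u ++ S) ℕ.< length w) (≡.sym regroup)
        (≡.subst (length (u ++ S) ℕ.<_) (≡.sym (length-++ (u ++ S))) (ℕ.m<m+n _ (s≤s z≤n)))
      front : take (length (u ++ S)) (u ++ S ++ i ∷ v) ≡ u ++ S
      front = ≡.trans (cong (take (length (u ++ S))) regroup)
        (≡.trans (take-++ (u ++ S) (i ∷ v) ℕ.≤-refl) (take-all _ (u ++ S) ℕ.≤-refl))

  -- `v` and `S` are suffixes of one word, so the shorter is a suffix of the longer. For a nonempty
  -- prefix `v` of `S` this is what makes `v` an overlap.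
  first⇒suffix-of : ∀ u v → length v ℕ.≤ length S → First (u ++ v) → Suffix _≡_ v S
  first⇒suffix-of u v v≤S f = suffix-comparable (u ++ˢ here (Pointwise.refl ≡.refl)) (first⇒suffix f) v≤S

  first-∷ʳ⇒¬occurs : ∀ u i → First (u ∷ʳ i) → ¬ Occurs u
  first-∷ʳ⇒¬occurs u i (_ , first) s = first {length u}
    (≡.subst (length u ℕ.<_) (≡.sym (≡.trans (length-++ u) (ℕ.+-comm (length u) 1))) ℕ.≤-refl)
    (≡.subst Occurs (≡.sym (≡.trans (take-++ u (i ∷ []) ℕ.≤-refl) (take-all _ u ℕ.≤-refl))) s)

  occurs-∷ʳ⇒first : ∀ u i → ¬ Occurs u → Occurs (u ∷ʳ i) → First (u ∷ʳ i)
  occurs-∷ʳ⇒first u i ¬s s = s , λ {j} j< sⱼ → ¬s (≡.subst Occurs (take++drop≡id j u)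
    (≡.subst Occurs (take-++ u (i ∷ []) (ℕ.s≤s⁻¹ (≡.subst (j ℕ.<_) (≡.trans (length-++ u) (ℕ.+-comm (length u) 1)) j<))) sⱼ
      ⁱ++ drop j u))

-- Probabilities of words and the renewal equation for the waiting time.

module _ (A : AsymptoticRing) where
  open AsymptoticRing A

  module WaitingTime {m : ℕ}
    (p : Fin m → Carrier) (p≥0 : ∀ i → 0# ≤ p i) (∑p≈1 : ∑ (allFin m) p ≈ 1#)
    (S : Word m) (S≢[] : S ≢ []) (c : Word m → Carrier)
    (c≥0 : ∀ {R} → R ∈ overlaps S → 0# ≤ c R)
    (c-inverse : ∀ {R} → R ∈ overlaps S → c R * foldr _*_ 1# (map p R) ≈ 1#)
    where
    open SetoidReasoning setoid
    open Occurrences S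
    open NaturalCoefficients commutativeSemiring using (solve; _:=_; _:+_; _:*_; con)

    prob : Word m → Carrier
    prob w = foldr _*_ 1# (map p w)

    prob≥0 : ∀ w → 0# ≤ prob w
    prob≥0 []      = 0≤1
    prob≥0 (i ∷ w) = *-nonNeg (p≥0 i) (prob≥0 w)

    𝔼 : ℕ → (Word m → Carrier) → Carrier
    𝔼 k f = ∑ (words m k) (λ w → prob w * f w)

    𝔼-cong : ∀ k {f g} → (∀ w → length w ≡ k → f w ≈ g w) → 𝔼 k f ≈ 𝔼 k g
    𝔼-cong k f≈g = ∑-cong (words m k) λ w∈ → *-congˡ (f≈g _ (Equivalence.to ∈-words w∈))

    𝔼-nonNeg : ∀ k {f} → (∀ w → 0# ≤ f w) → 0# ≤ 𝔼 k f
    𝔼-nonNeg k f≥0 = ∑-nonNeg (words m k) λ {w} _ → *-nonNeg (prob≥0 w) (f≥0 w)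

    𝔼-zero : ∀ k {f} → (∀ w → length w ≡ k → f w ≈ 0#) → 𝔼 k f ≈ 0#
    𝔼-zero k f≈0 = ∑-zero (words m k) λ w∈ → trans (*-congˡ (f≈0 _ (Equivalence.to ∈-words w∈))) (zeroʳ _)

    𝔼-+ : ∀ k f g → 𝔼 k (λ w → f w + g w) ≈ 𝔼 k f + 𝔼 k g
    𝔼-+ k f g = trans (∑-cong (words m k) λ _ → distribˡ _ _ _) (∑-+ (words m k) _ _)

    𝔼-*ˡ : ∀ k a f → 𝔼 k (λ w → a * f w) ≈ a * 𝔼 k f
    𝔼-*ˡ k a f = trans (∑-cong (words m k) λ _ → solve 3 (λ x y z → x :* (y :* z) := y :* (x :* z)) refl _ _ _)
      (∑-*ˡ (words m k) a _)

    𝔼-[] : ∀ f → 𝔼 0 f ≈ f []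
    𝔼-[] f = trans (+-identityʳ _) (*-identityˡ _)

    𝔼-suc : ∀ k f → 𝔼 (suc k) f ≈ ∑ (allFin m) (λ i → p i * 𝔼 k (f ∘ (i ∷_)))
    𝔼-suc k f = trans (∑-cartesianProductWith _∷_ (allFin m) (words m k) _)
      (∑-cong (allFin m) λ {i} _ → trans (∑-cong (words m k) λ _ → *-assoc _ _ _) (∑-*ˡ (words m k) (p i) _))

    -- Independence of the first `k` rolls and the next `l`.
    𝔼-++ : ∀ k l f → 𝔼 (k ℕ.+ l) f ≈ 𝔼 k (λ u → 𝔼 l (λ v → f (u ++ v)))
    𝔼-++ zero    l f = sym (𝔼-[] (λ u → 𝔼 l (λ v → f (u ++ v))))
    𝔼-++ (suc k) l f = begin
      𝔼 (suc (k ℕ.+ l)) f                                                     ≈⟨ 𝔼-suc (k ℕ.+ l) f ⟩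
      ∑ (allFin m) (λ i → p i * 𝔼 (k ℕ.+ l) (f ∘ (i ∷_)))                      ≈⟨ ∑-cong (allFin m) (λ _ → *-congˡ (𝔼-++ k l _)) ⟩
      ∑ (allFin m) (λ i → p i * 𝔼 k (λ u → 𝔼 l (λ v → f (i ∷ u ++ v))))        ≈⟨ 𝔼-suc k _ ⟨
      𝔼 (suc k) (λ u → 𝔼 l (λ v → f (u ++ v)))                                 ∎

    𝔼-const : ∀ k x → 𝔼 k (λ _ → x) ≈ x
    𝔼-const zero    x = 𝔼-[] (λ _ → x)
    𝔼-const (suc k) x = begin
      𝔼 (suc k) (λ _ → x)                        ≈⟨ 𝔼-suc k _ ⟩
      ∑ (allFin m) (λ i → p i * 𝔼 k (λ _ → x))   ≈⟨ ∑-cong (allFin m) (λ _ → *-congˡ (𝔼-const k x)) ⟩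
      ∑ (allFin m) (λ i → p i * x)               ≈⟨ ∑-*ʳ (allFin m) x p ⟩
      ∑ (allFin m) p * x                         ≈⟨ trans (*-congʳ ∑p≈1) (*-identityˡ x) ⟩
      x                                          ∎

    𝔼-point : ∀ R f → (∀ w → length w ≡ length R → w ≢ R → f w ≈ 0#) → 𝔼 (length R) f ≈ prob R * f R
    𝔼-point R f f≈0 = trans (∑-cong (words m (length R)) λ {w} w∈ → sym (masked w (Equivalence.to ∈-words w∈)))
      (trans (∑-single mask (words-unique m (length R)) (Equivalence.from ∈-words ≡.refl) off) (masked R ≡.refl))
      where
        -- `∑-single` wants a summand vanishing at every word other than `R`, whereas `f` is
        -- controlled only at words of the length of `R`.
        mask : Word m → Carrier
        mask w with ≡-dec _≟ᶠ_ w R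
        ... | yes _ = prob w * f w
        ... | no _  = 0#
        masked : ∀ w → length w ≡ length R → mask w ≈ prob w * f w
        masked w eq with ≡-dec _≟ᶠ_ w R
        ... | yes _  = refl
        ... | no w≢R = sym (trans (*-congˡ (f≈0 w eq w≢R)) (zeroʳ _))
        off : ∀ {w} → w ≢ R → mask w ≈ 0#
        off {w} w≢R with ≡-dec _≟ᶠ_ w R
        ... | yes w≡R = ⊥-elim (w≢R w≡R)
        ... | no _    = refl

    indicator : ∀ {X : Set} → Dec X → Carrier
    indicator (yes _) = 1#
    indicator (no _)  = 0#

    indicator-yes : ∀ {X : Set} (d : Dec X) → X → indicator d ≈ 1#
    indicator-yes (yes _) _ = refl
    indicator-yes (no ¬x) x = ⊥-elim (¬x x)

    indicator-no : ∀ {X : Set} (d : Dec X) → ¬ X → indicator d ≈ 0#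
    indicator-no (yes x) ¬x = ⊥-elim (¬x x)
    indicator-no (no _)  _  = refl

    indicator≥0 : ∀ {X : Set} (d : Dec X) → 0# ≤ indicator d
    indicator≥0 (yes _) = 0≤1
    indicator≥0 (no _)  = ≤-refl

    hit avoid : Word m → Carrier
    hit w   = indicator (first? w)
    avoid w = indicator (¬? (infix? _≟ᶠ_ S w))

    -- If `u` avoids `S`, the new letter either completes `S` for the first time or keeps it
    -- avoided; if `S` occurs in `u`, all three terms vanish.
    avoid-∷ʳ : ∀ u i → avoid u ≈ hit (u ∷ʳ i) + avoid (u ∷ʳ i)
    avoid-∷ʳ u i = go (infix? _≟ᶠ_ S u) (infix? _≟ᶠ_ S (u ∷ʳ i)) (first? (u ∷ʳ i))
      where
        go : (d : Dec (Occurs u)) (d′ : Dec (Occurs (u ∷ʳ i))) (f : Dec (First (u ∷ʳ i))) →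
             indicator (¬? d) ≈ indicator f + indicator (¬? d′)
        go (yes s) (yes _)  f = sym (trans (+-identityʳ _) (indicator-no f λ f → first-∷ʳ⇒¬occurs u i f s))
        go (yes s) (no ¬s′) f = ⊥-elim (¬s′ (s ⁱ++ (i ∷ [])))
        go (no ¬s) (yes s′) f = sym (trans (+-identityʳ _) (indicator-yes f (occurs-∷ʳ⇒first u i ¬s s′)))
        go (no ¬s) (no ¬s′) f = sym (trans (+-congʳ (indicator-no f (¬s′ ∘ proj₁))) (+-identityˡ _))

    -- Iteration of `avoid-∷ʳ` along `y`: when `u` avoids `S`, the first completion comes after
    -- exactly one nonempty prefix of `y` or not at all.
    avoid-++ : ∀ u y → avoid u ≈ ∑ (prefixes y) (λ v → hit (u ++ v)) + avoid (u ++ y)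
    avoid-++ u []      = sym (trans (+-identityˡ _) (reflexive (cong avoid (++-identityʳ u))))
    avoid-++ u (i ∷ y) = begin
      avoid u
        ≈⟨ avoid-∷ʳ u i ⟩
      hit (u ∷ʳ i) + avoid (u ∷ʳ i)
        ≈⟨ +-congˡ (avoid-++ (u ∷ʳ i) y) ⟩
      hit (u ∷ʳ i) + (∑ (prefixes y) (λ v → hit (u ∷ʳ i ++ v)) + avoid (u ∷ʳ i ++ y))
        ≈⟨ +-assoc _ _ _ ⟨
      hit (u ∷ʳ i) + ∑ (prefixes y) (λ v → hit (u ∷ʳ i ++ v)) + avoid (u ∷ʳ i ++ y)
        ≈⟨ +-cong (+-congˡ (trans (∑-cong (prefixes y) λ {v} _ → reflexive (cong hit (∷ʳ-++ u i v)))
                     (reflexive (≡.sym (∑-map (i ∷_) (prefixes y) _)))))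
                  (reflexive (cong avoid (∷ʳ-++ u i y))) ⟩
      hit (u ∷ʳ i) + ∑ (map (i ∷_) (prefixes y)) (λ v → hit (u ++ v)) + avoid (u ++ i ∷ y) ∎

    t a : ℕ → Carrier
    t k = 𝔼 k avoid
    a k = ∑ (filter (base? (equals (waitingTime S) k)) (words m k)) prob

    a≈𝔼 : ∀ k → a k ≈ 𝔼 k hit
    a≈𝔼 k = ∑-filter (base? (equals (waitingTime S) k)) (words m k)
      (λ w∈ f → sym (trans (*-congˡ (on (Equivalence.to ∈-words w∈) f)) (*-identityʳ _)))
      (λ w∈ ¬f → trans (*-congˡ (off (Equivalence.to ∈-words w∈) ¬f)) (zeroʳ _))
      where
        on : ∀ {k w} → length w ≡ k → FirstAt k w → hit w ≈ 1#
        on {w = w} ≡.refl = indicator-yes (first? w)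
        off : ∀ {k w} → length w ≡ k → ¬ FirstAt k w → hit w ≈ 0#
        off {w = w} ≡.refl = indicator-no (first? w)

    a≥0 : ∀ k → 0# ≤ a k
    a≥0 k = ≤-trans (𝔼-nonNeg k (indicator≥0 ∘ first?)) (≤-reflexive (sym (a≈𝔼 k)))

    t≥0 : ∀ k → 0# ≤ t k
    t≥0 k = 𝔼-nonNeg k (λ w → indicator≥0 (¬? (infix? _≟ᶠ_ S w)))

    0<∣S∣ : 0 ℕ.< length S
    0<∣S∣ = nonempty S S≢[]
      where
        nonempty : ∀ (w : Word m) → w ≢ [] → 0 ℕ.< length w
        nonempty []      w≢[] = ⊥-elim (w≢[] ≡.refl)
        nonempty (_ ∷ _) _    = s≤s z≤n

    a-early : ∀ {k} → k ℕ.< length S → a k ≈ 0#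
    a-early {k} k<S = trans (a≈𝔼 k) (𝔼-zero k λ w eq → indicator-no (first? w) λ (s , _) →
      ℕ.<⇒≱ k<S (ℕ.≤-trans (Infix.length-mono s) (ℕ.≤-reflexive eq)))

    t₀ : t 0 ≈ 1#
    t₀ = trans (𝔼-[] avoid) (indicator-yes (¬? (infix? _≟ᶠ_ S [])) λ s → ℕ.<⇒≱ 0<∣S∣ (Infix.length-mono s))

    -- One more roll is averaged in, which is free because the probabilities sum to 1; then
    -- `avoid-∷ʳ` sorts the cases by its effect.
    t-step : ∀ k → t k ≈ a (suc k) + t (suc k)
    t-step k = begin
      𝔼 k avoid
        ≈⟨ 𝔼-cong k (λ u _ → trans (sym (𝔼-const 1 (avoid u))) (𝔼-cong 1 (letter u))) ⟩
      𝔼 k (λ u → 𝔼 1 (λ v → hit (u ++ v) + avoid (u ++ v)))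
        ≈⟨ 𝔼-++ k 1 _ ⟨
      𝔼 (k ℕ.+ 1) (λ w → hit w + avoid w)
        ≡⟨ cong (λ j → 𝔼 j (λ w → hit w + avoid w)) (ℕ.+-comm k 1) ⟩
      𝔼 (suc k) (λ w → hit w + avoid w)
        ≈⟨ trans (𝔼-+ (suc k) hit avoid) (+-congʳ (sym (a≈𝔼 (suc k)))) ⟩
      a (suc k) + t (suc k) ∎
      where
        letter : ∀ u v → length v ≡ 1 → avoid u ≈ hit (u ++ v) + avoid (u ++ v)
        letter u (i ∷ []) _ = avoid-∷ʳ u i

    𝔼-∑ : ∀ {I : Set} k (xs : List I) (f : I → Word m → Carrier) → 𝔼 k (λ w → ∑ xs (λ x → f x w)) ≈ ∑ xs (λ x → 𝔼 k (f x))
    𝔼-∑ k []       f = 𝔼-zero k (λ _ _ → refl)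
    𝔼-∑ k (x ∷ xs) f = trans (𝔼-+ k (f x) _) (+-congˡ (𝔼-∑ k xs f))

    -- A first completion of S after |R| further letters forces these letters to be R.
    overlap-hit : ∀ k {R} → R ∈ overlaps S → 𝔼 k (λ u → hit (u ++ R)) ≈ c R * a (k ℕ.+ length R)
    overlap-hit k {R} R∈ = sym (begin
      c R * a (k ℕ.+ length R)
        ≈⟨ *-congˡ (trans (a≈𝔼 (k ℕ.+ length R)) (𝔼-++ k (length R) hit)) ⟩
      c R * 𝔼 k (λ u → 𝔼 (length R) (λ v → hit (u ++ v)))
        -- A hit at `u ++ v` makes `v` a suffix of `S`; so is `R`, and suffixes of equal length
        -- coincide.
        ≈⟨ *-congˡ (𝔼-cong k λ u _ → 𝔼-point R _ λ v eq v≢R → indicator-no (first? (u ++ v)) λ f →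
             v≢R (suffix-unique (first⇒suffix-of u v (ℕ.≤-trans (ℕ.≤-reflexive eq) (Suffix.length-mono R⊑S)) f) R⊑S eq)) ⟩
      c R * 𝔼 k (λ u → prob R * hit (u ++ R))
        ≈⟨ *-congˡ (𝔼-*ˡ k (prob R) _) ⟩
      c R * (prob R * 𝔼 k (λ u → hit (u ++ R)))
        ≈⟨ trans (sym (*-assoc _ _ _)) (trans (*-congʳ (c-inverse R∈)) (*-identityˡ _)) ⟩
      𝔼 k (λ u → hit (u ++ R)) ∎)
      where
        R⊑S : Suffix _≡_ R S
        R⊑S = proj₂ (proj₂ (Equivalence.to (∈-overlaps {S = S}) R∈))

    renewal : ∀ k → t k ≈ ∑ (overlaps S) (λ R → c R * a (k ℕ.+ length R))
    renewal k = begin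
      𝔼 k avoid
        ≈⟨ 𝔼-cong k (λ u _ → trans (avoid-++ u S) (trans (+-congˡ (indicator-no (¬? (infix? _≟ᶠ_ S (u ++ S))) λ ¬s → ¬s (occurs-last u))) (+-identityʳ _))) ⟩
      𝔼 k (λ u → ∑ (prefixes S) (λ R → hit (u ++ R)))
        ≈⟨ 𝔼-∑ k (prefixes S) _ ⟩
      ∑ (prefixes S) (λ R → 𝔼 k (λ u → hit (u ++ R)))
        -- `overlap? S []` computes to a negative answer, so `overlaps S` is by definition the
        -- filtered list of nonempty prefixes.
        ≈⟨ ∑-filter (overlap? S) (prefixes S) (λ _ o → sym (overlap-hit k (Equivalence.from ∈-overlaps o)))
             (λ {R} R∈ ¬o → 𝔼-zero k λ u _ → indicator-no (first? (u ++ R)) λ f → ¬o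
               ( ∈-prefixes⇒nonempty S R∈ , ∈-inits⇒prefix S (there R∈)
               , first⇒suffix-of u R (Prefix.length-mono (∈-inits⇒prefix S (there R∈))) f)) ⟨
      ∑ (overlaps S) (λ R → c R * a (k ℕ.+ length R)) ∎

    overlap-length≥1 : ∀ {R} → R ∈ overlaps S → 1 ℕ.≤ length R
    overlap-length≥1 {[]}    R∈ = ⊥-elim (proj₁ (Equivalence.to (∈-overlaps {S = S}) R∈) ≡.refl)
    overlap-length≥1 {_ ∷ _} R∈ = s≤s z≤n

    overlap-length≤ : ∀ {R} → R ∈ overlaps S → length R ℕ.≤ length S
    overlap-length≤ R∈ = Prefix.length-mono (proj₁ (proj₂ (Equivalence.to (∈-overlaps {S = S}) R∈)))

    open Renewal A (overlaps S) c length a t c≥0 overlap-length≥1 a≥0 t≥0 (a-early 0<∣S∣)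
      (λ R∈ j<R → a-early (ℕ.<-≤-trans j<R (overlap-length≤ R∈)))
      t₀ t-step renewal public
      using (G; moments-setPartitions)

-- The moment formula in terms of integers and overlap sums.

-- d R∈ is 1 / P(R); being given only for overlaps, it is extended by zero to c.
module _ (A : AsymptoticRing) where
  open AsymptoticRing A

  module WaitingMoments {m : ℕ}
    (p : Fin m → Carrier) (p≥0 : ∀ i → 0# ≤ p i) (∑p≈1 : ∑ (allFin m) p ≈ 1#)
    (S : Word m) (S≢[] : S ≢ []) (d : ∀ {R} → R ∈ overlaps S → Carrier)
    (d-irrelevant : ∀ {R} (i j : R ∈ overlaps S) → d i ≈ d j)
    (d≥0 : ∀ {R} (R∈ : R ∈ overlaps S) → 0# ≤ d R∈)
    (d-inverse : ∀ {R} (R∈ : R ∈ overlaps S) → d R∈ * foldr _*_ 1# (map p R) ≈ 1#)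
    (int : ℤ → Carrier) (int-hom : IsRingHomomorphism ℤ.+-*-rawRing (CommutativeRing.rawRing commutativeRing) int)
    where
    open IsRingHomomorphism int-hom

    c : Word m → Carrier
    c R with overlap? S R
    ... | yes o = d (Equivalence.from ∈-overlaps o)
    ... | no _  = 0#

    c≈d : ∀ {R} (R∈ : R ∈ overlaps S) → c R ≈ d R∈
    c≈d {R} R∈ with overlap? S R
    ... | yes o = d-irrelevant (Equivalence.from ∈-overlaps o) R∈
    ... | no ¬o = ⊥-elim (¬o (Equivalence.to (∈-overlaps {S = S}) R∈))

    open WaitingTime A p p≥0 ∑p≈1 S S≢[] c
      (λ R∈ → ≤-trans (d≥0 R∈) (≤-reflexive (sym (c≈d R∈))))
      (λ R∈ → trans (*-congʳ (c≈d R∈)) (d-inverse R∈))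

    int-+ : ∀ k → int (ℤ.+ k) ≈ ι k
    int-+ zero    = 0#-homo
    int-+ (suc k) = trans (+-homo (ℤ.+ 1) (ℤ.+ k)) (+-cong 1#-homo (int-+ k))

    int-^ : ∀ i n → int (i ℤ.^ n) ≈ int i ^ n
    int-^ i zero    = 1#-homo
    int-^ i (suc n) = trans (*-homo i (i ℤ.^ n)) (*-congˡ (int-^ i n))

    overlapTotal : ℕ → Carrier
    overlapTotal b = foldr _+_ 0# (mapWith∈ (overlaps S) λ {R} R∈ →
      int ((ℤ.1ℤ ℤ.- ℤ.+ length R) ℤ.^ b ℤ.- (ℤ.- (ℤ.+ length R)) ℤ.^ b) * d R∈)

    overlapTotal≈G : ∀ b → overlapTotal b ≈ G b
    overlapTotal≈G b = sum-mapWith∈ (overlaps S) λ {R} R∈ →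
      trans (*-comm _ _) (*-cong (sym (c≈d R∈)) (kernel-int (length R)))
      where
        sum-mapWith∈ : ∀ {I : Set} (xs : List I) {f : ∀ {x} → x ∈ xs → Carrier} {g : I → Carrier} →
          (∀ {x} (x∈ : x ∈ xs) → f x∈ ≈ g x) → foldr _+_ 0# (mapWith∈ xs f) ≈ ∑ xs g
        sum-mapWith∈ []       f≈g = refl
        sum-mapWith∈ (x ∷ xs) f≈g = +-cong (f≈g (here ≡.refl)) (sum-mapWith∈ xs (f≈g ∘ there))
        kernel-int : ∀ r → int ((ℤ.1ℤ ℤ.- ℤ.+ r) ℤ.^ b ℤ.- (ℤ.- (ℤ.+ r)) ℤ.^ b) ≈ (1# - ι r) ^ b - (- ι r) ^ b
        kernel-int r = trans (+-homo _ (ℤ.- ((ℤ.- (ℤ.+ r)) ℤ.^ b))) (+-cong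
          (trans (int-^ (ℤ.1ℤ ℤ.- ℤ.+ r) b) (^-congˡ b (trans (+-homo ℤ.1ℤ (ℤ.- (ℤ.+ r))) (+-cong 1#-homo neg))))
          (trans (-‿homo _) (-‿cong (trans (int-^ (ℤ.- (ℤ.+ r)) b) (^-congˡ b neg)))))
          where
            neg : int (ℤ.- (ℤ.+ r)) ≈ - ι r
            neg = trans (-‿homo (ℤ.+ r)) (-‿cong (int-+ r))

    ∑<-cong : ∀ k {x y} → (∀ j → x j ≈ y j) → ∑< k x ≈ ∑< k y
    ∑<-cong zero    x≈y = refl
    ∑<-cong (suc k) x≈y = +-cong (∑<-cong k x≈y) (x≈y k)

    product-cong : ∀ {I : Set} (xs : List I) {f g} → (∀ x → f x ≈ g x) →
                   foldr _*_ 1# (map f xs) ≈ foldr _*_ 1# (map g xs)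
    product-cong []       f≈g = refl
    product-cong (x ∷ xs) f≈g = *-cong (f≈g x) (product-cong xs f≈g)

    -- The moment formula for order 0: `setPartitions 0` holds only the empty partition, which
    -- contributes 1, and every weight `e j 0` is 1.
    total-mass : Null (λ k → foldr _+_ 0# (applyUpTo a (suc k)) - 1#)
    total-mass = null-cong
      (λ k → +-cong (trans (∑<-cong (suc k) λ j → *-identityʳ (a j)) (sym (∑<-applyUpTo (suc k) a)))
        (-‿cong (trans (+-identityʳ _) (trans (*-identityʳ _) (+-identityʳ _)))))
      (moments-setPartitions 0)

    -- `x` and `y` are known only up to `≈`, so that an instance can supply its own form of the
    -- summands together with equivalences.
    moment : ∀ n (x : ℕ → Carrier) (y : List (Subset n) → Carrier) → (∀ k → x k ≈ int (ℤ.+ (k ℕ.^ n)) * a k) →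
      (∀ π → y π ≈ int (ℤ.+ (length π !)) * foldr _*_ 1# (map (λ B → overlapTotal ∣ B ∣) π)) →
      Null (λ k → foldr _+_ 0# (applyUpTo x (suc k)) - ∑ (setPartitions n) y)
    moment n x y x≈ y≈ = null-cong
      (λ k → +-cong
        (trans (∑<-cong (suc k) λ j → trans (*-comm _ _)
            (sym (trans (x≈ j) (*-congʳ (trans (int-+ (j ℕ.^ n)) (ι-^ j n))))))
          (sym (∑<-applyUpTo (suc k) x)))
        (-‿cong (∑-cong (setPartitions n) λ {π} _ →
          sym (trans (y≈ π) (*-cong (int-+ (length π !)) (product-cong π λ B → overlapTotal≈G ∣ B ∣))))))
      (moments-setPartitions n)

-- The Cauchy reals as an ordered ring with null sequences.

-- `_/_` normalises fractions. The law is therefore checked on unnormalised rationals, where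
-- equality is cross-multiplication.
/1-+ : ∀ a b → (a ℤ.+ b) ℚ./ 1 ≡ a ℚ./ 1 ℚ.+ b ℚ./ 1
/1-+ a b = ℚ.toℚᵘ-injective (ℚᵘ.≃-trans (ℚ.toℚᵘ-fromℚᵘ (mkℚᵘ (a ℤ.+ b) 0))
  (ℚᵘ.≃-trans (*≡* (solve 2 (λ a b → (a :+ b) :* con (ℤ.+ 1) := (a :* con (ℤ.+ 1) :+ b :* con (ℤ.+ 1)) :* con (ℤ.+ 1)) ≡.refl a b))
  (ℚᵘ.≃-sym (ℚᵘ.≃-trans (ℚ.toℚᵘ-homo-+ (a ℚ./ 1) (b ℚ./ 1))
    (ℚᵘ.+-cong (ℚ.toℚᵘ-fromℚᵘ (mkℚᵘ a 0)) (ℚ.toℚᵘ-fromℚᵘ (mkℚᵘ b 0)))))))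
  where open ℤ.+-*-Solver

/1-* : ∀ a b → (a ℤ.* b) ℚ./ 1 ≡ (a ℚ./ 1) ℚ.* (b ℚ./ 1)
/1-* a b = ℚ.toℚᵘ-injective (ℚᵘ.≃-trans (ℚ.toℚᵘ-fromℚᵘ (mkℚᵘ (a ℤ.* b) 0))
  (ℚᵘ.≃-sym (ℚᵘ.≃-trans (ℚ.toℚᵘ-homo-* (a ℚ./ 1) (b ℚ./ 1))
    (ℚᵘ.*-cong (ℚ.toℚᵘ-fromℚᵘ (mkℚᵘ a 0)) (ℚ.toℚᵘ-fromℚᵘ (mkℚᵘ b 0))))))

/1-neg : ∀ a → (ℤ.- a) ℚ./ 1 ≡ ℚ.- (a ℚ./ 1)
/1-neg a = ℚ.toℚᵘ-injective (ℚᵘ.≃-trans (ℚ.toℚᵘ-fromℚᵘ (mkℚᵘ (ℤ.- a) 0))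
  (ℚᵘ.≃-sym (ℚᵘ.≃-trans (ℚ.toℚᵘ-homo‿- (a ℚ./ 1)) (ℚᵘ.-‿cong (ℚ.toℚᵘ-fromℚᵘ (mkℚᵘ a 0))))))

private
  open ℚ.+-*-Solver

  halve : ∀ {ε} → 0ℚ ℚ.< ε → ∃ λ δ → 0ℚ ℚ.< δ × δ ℚ.+ δ ≡ ε
  halve {ε} ε>0 = ½ ℚ.* ε
    , subst (ℚ._< ½ ℚ.* ε) (ℚ.*-zeroʳ ½) (ℚ.*-monoʳ-<-pos ½ ε>0)
    , ≡.trans (≡.sym (ℚ.*-distribʳ-+ ε ½ ½)) (ℚ.*-identityˡ ε)

  *-pos : ∀ {a b} → 0ℚ ℚ.< a → 0ℚ ℚ.< b → 0ℚ ℚ.< a ℚ.* b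
  *-pos {a} {b} a>0 b>0 = subst (ℚ._< a ℚ.* b) (ℚ.*-zeroʳ a) (ℚ.*-monoʳ-<-pos a {{ℚ.positive a>0}} b>0)

  shrink : ∀ {b ε} → 0ℚ ℚ.< b → 0ℚ ℚ.< ε → ∃ λ δ → 0ℚ ℚ.< δ × b ℚ.* δ ≡ ε
  shrink {b} {ε} b>0 ε>0 = ℚ.1/ b ℚ.* ε
    , *-pos (ℚ.positive⁻¹ (ℚ.1/ b) {{ℚ.1/pos⇒pos b}}) ε>0
    , ≡.trans (≡.sym (ℚ.*-assoc b (ℚ.1/ b) ε)) (≡.trans (cong (ℚ._* ε) (ℚ.*-inverseʳ b)) (ℚ.*-identityˡ ε))
    where
      instance
        b⁺ : ℚ.Positive b
        b⁺ = ℚ.positive b>0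
        b≠0 : ℚ.NonZero b
        b≠0 = ℚ.pos⇒nonZero b

  shrink≤1 : ∀ {b ε} → 0ℚ ℚ.< b → 0ℚ ℚ.< ε → ∃ λ δ → 0ℚ ℚ.< δ × δ ℚ.≤ 1ℚ × b ℚ.* δ ℚ.≤ ε
  shrink≤1 {b} b>0 ε>0 with δ , δ>0 , eq ← shrink b>0 ε>0 with ℚ.≤-total δ 1ℚ
  ... | inj₁ δ≤1 = δ , δ>0 , δ≤1 , ℚ.≤-reflexive eq
  ... | inj₂ 1≤δ = 1ℚ , ℚ.positive⁻¹ 1ℚ , ℚ.≤-refl
    , ℚ.≤-trans (ℚ.*-monoˡ-≤-nonNeg b {{ℚ.nonNegative (ℚ.<⇒≤ b>0)}} 1≤δ) (ℚ.≤-reflexive eq)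

  ∣∣< : ∀ {t ε} → ℚ.- ε ℚ.< t → t ℚ.< ε → ℚ.∣ t ∣ ℚ.< ε
  ∣∣< {t} {ε} -ε<t t<ε with ℚ.∣p∣≡p∨∣p∣≡-p t
  ... | inj₁ eq = subst (ℚ._< ε) (≡.sym eq) t<ε
  ... | inj₂ eq = subst₂ ℚ._<_ (≡.sym eq) (solve 1 (λ e → :- (:- e) := e) ≡.refl ε) (ℚ.neg-antimono-< -ε<t)

  p<p+q : ∀ p {q} → 0ℚ ℚ.< q → p ℚ.< p ℚ.+ q
  p<p+q p {q} q>0 = subst (ℚ._< p ℚ.+ q) (ℚ.+-identityʳ p) (ℚ.+-monoʳ-< p q>0)

  n≤∣n∣ : ∀ n → n ℤ.≤ ℤ.+ ℤ.∣ n ∣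
  n≤∣n∣ (ℤ.+ n)      = ℤ.≤-refl
  n≤∣n∣ ℤ.-[1+ n ] = ℤ.-≤+

  -- The denominator is at least 1, so the size of the numerator bounds the fraction; this gives
  -- `archimedean` its explicit threshold.
  ∣↥z∣<k⇒z<k : ∀ z k → ℤ.∣ ℚ.↥ z ∣ ℕ.< k → z ℚ.< ℤ.+ k ℚ./ 1
  ∣↥z∣<k⇒z<k (ℚ.mkℚ n d-1 _) k n<k = ℚ.toℚᵘ-cancel-< (ℚᵘ.<-respʳ-≃ (ℚᵘ.≃-sym (ℚ.toℚᵘ-fromℚᵘ (mkℚᵘ (ℤ.+ k) 0)))
    (*<* (subst (ℤ._< ℤ.+ k ℤ.* ℤ.+ suc d-1) (≡.sym (ℤ.*-identityʳ n))
      (ℤ.≤-<-trans (n≤∣n∣ n) (ℤ.<-≤-trans (ℤ.+<+ n<k)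
        (subst (ℤ.+ k ℤ.≤_) (ℤ.pos-* k (suc d-1)) (ℤ.+≤+ (ℕ.m≤m*n k (suc d-1)))))))))

  archimedean : ∀ q ε → 0ℚ ℚ.< ε → Eventually λ k → q ℚ.< (ℤ.+ k ℚ./ 1) ℚ.* ε
  archimedean q ε ε>0 = suc ℤ.∣ ℚ.↥ z ∣ , λ k N≤k →
    subst (ℚ._< (ℤ.+ k ℚ./ 1) ℚ.* ε) z*ε≡q (ℚ.*-monoˡ-<-pos ε (∣↥z∣<k⇒z<k z k N≤k))
    where
      instance
        ε⁺ : ℚ.Positive ε
        ε⁺ = ℚ.positive ε>0
        ε≠0 : ℚ.NonZero ε
        ε≠0 = ℚ.pos⇒nonZero ε
      z = q ℚ.* ℚ.1/ ε
      z*ε≡q : z ℚ.* ε ≡ q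
      z*ε≡q = ≡.trans (ℚ.*-assoc q (ℚ.1/ ε) ε) (≡.trans (cong (q ℚ.*_) (ℚ.*-inverseˡ ε)) (ℚ.*-identityʳ q))

  infixr 4 _and_
  _and_ : ∀ {P Q : ℕ → Set} → Eventually P → Eventually Q → Eventually (λ i → P i × Q i)
  (N , p) and (M , q) = N ℕ.⊔ M , λ i ≤i → p i (ℕ.m⊔n≤o⇒m≤o N M ≤i) , q i (ℕ.m⊔n≤o⇒n≤o N M ≤i)

  eventually : ∀ {P Q : ℕ → Set} → (∀ i → P i → Q i) → Eventually P → Eventually Q
  eventually f (N , p) = N , λ i ≤i → f i (p i ≤i)

  bounded : ∀ x → ∃ λ b → 0ℚ ℚ.< b × Eventually λ i → ℚ.∣ seq x i ∣ ℚ.≤ b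
  bounded x = 1ℚ ℚ.+ b
    , ℚ.<-≤-trans (ℚ.positive⁻¹ 1ℚ) (subst (ℚ._≤ 1ℚ ℚ.+ b) (ℚ.+-identityʳ 1ℚ) (ℚ.+-monoʳ-≤ 1ℚ (ℚ.0≤∣p∣ (seq x N))))
    , N , λ i N≤i → subst (λ t → ℚ.∣ t ∣ ℚ.≤ 1ℚ ℚ.+ b)
        (solve 2 (λ u v → (u :- v) :+ v := u) ≡.refl (seq x i) (seq x N))
        (ℚ.≤-trans (ℚ.∣p+q∣≤∣p∣+∣q∣ (seq x i ℚ.- seq x N) (seq x N))
          (ℚ.+-monoˡ-≤ b (ℚ.<⇒≤ (proj₂ (cauchy x 1ℚ (ℚ.positive⁻¹ 1ℚ)) i N N≤i ℕ.≤-refl))))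
    where
      N = proj₁ (cauchy x 1ℚ (ℚ.positive⁻¹ 1ℚ))
      b = ℚ.∣ seq x N ∣

Nullℚ : (ℕ → ℚ) → Set
Nullℚ d = ∀ ε → 0ℚ ℚ.< ε → Eventually λ i → ℚ.∣ d i ∣ ℚ.< ε

private
  nullℚ-0 : ∀ {d} → (∀ i → d i ≡ 0ℚ) → Nullℚ d
  nullℚ-0 d≡0 ε ε>0 = 0 , λ i _ → subst (ℚ._< ε) (≡.sym (cong ℚ.∣_∣ (d≡0 i))) ε>0

  nullℚ-cong : ∀ {d e} → (∀ i → d i ≡ e i) → Nullℚ d → Nullℚ e
  nullℚ-cong d≡e null ε ε>0 = eventually (λ i → subst (λ t → ℚ.∣ t ∣ ℚ.< ε) (d≡e i)) (null ε ε>0)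

  ∣+∣< : ∀ {p q δ ε} → ℚ.∣ p ∣ ℚ.< δ → ℚ.∣ q ∣ ℚ.< δ → δ ℚ.+ δ ≡ ε → ℚ.∣ p ℚ.+ q ∣ ℚ.< ε
  ∣+∣< {p} {q} p<δ q<δ eq = ℚ.≤-<-trans (ℚ.∣p+q∣≤∣p∣+∣q∣ p q) (subst (ℚ.∣ p ∣ ℚ.+ ℚ.∣ q ∣ ℚ.<_) eq (ℚ.+-mono-< p<δ q<δ))

  ∣*∣< : ∀ {p q b δ ε} → 0ℚ ℚ.< b → ℚ.∣ p ∣ ℚ.≤ b → ℚ.∣ q ∣ ℚ.< δ → b ℚ.* δ ≡ ε → ℚ.∣ p ℚ.* q ∣ ℚ.< ε
  ∣*∣< {p} {q} {b} b>0 p≤b q<δ eq = ℚ.≤-<-trans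
    (subst (ℚ._≤ b ℚ.* ℚ.∣ q ∣) (≡.sym (ℚ.∣p*q∣≡∣p∣*∣q∣ p q))
      (ℚ.*-monoʳ-≤-nonNeg ℚ.∣ q ∣ {{ℚ.∣-∣-nonNeg q}} p≤b))
    (subst (b ℚ.* ℚ.∣ q ∣ ℚ.<_) eq (ℚ.*-monoʳ-<-pos b {{ℚ.positive b>0}} q<δ))

  nullℚ-+ : ∀ {d e} → Nullℚ d → Nullℚ e → Nullℚ (λ i → d i ℚ.+ e i)
  nullℚ-+ {d} {e} null null′ ε ε>0 = let δ , δ>0 , eq = halve ε>0 in
    eventually (λ i (d<δ , e<δ) → ∣+∣< {d i} {e i} d<δ e<δ eq) (null δ δ>0 and null′ δ δ>0)

  nullℚ-* : ∀ x {d} → Nullℚ d → Nullℚ (λ i → seq x i ℚ.* d i)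
  nullℚ-* x {d} null ε ε>0 = let b , b>0 , x≤b = bounded x ; δ , δ>0 , eq = shrink b>0 ε>0 in
    eventually (λ i (x≤b , d<δ) → ∣*∣< {seq x i} {d i} b>0 x≤b d<δ eq) (x≤b and null δ δ>0)

  nullℚ-neg : ∀ {d} → Nullℚ d → Nullℚ (λ i → ℚ.- d i)
  nullℚ-neg {d} null ε ε>0 = eventually (λ i → subst (ℚ._< ε) (≡.sym (ℚ.∣-p∣≡∣p∣ (d i)))) (null ε ε>0)

-- _≃_ and _≤ℝ_ unfold to function types, from which Agda cannot infer the two reals; these records can.
infix 4 _≈ℝ_ _≲ℝ_

record _≈ℝ_ (x y : ℝ) : Set where
  constructor ≈⁺
  field ≈⁻ : x ≃ y
open _≈ℝ_ public

record _≲ℝ_ (x y : ℝ) : Set where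
  constructor ≲⁺
  field ≲⁻ : x ≤ℝ y
open _≲ℝ_ public

pointwise : ∀ {x y} → (∀ i → seq x i ≡ seq y i) → x ≈ℝ y
pointwise {x} {y} x≡y = ≈⁺ (nullℚ-0 λ i → ≡.trans (cong (ℚ._- seq y i) (x≡y i)) (ℚ.+-inverseʳ (seq y i)))

ℝ-commutativeRing : CommutativeRing 0ℓ 0ℓ
ℝ-commutativeRing = record
  { Carrier = ℝ ; _≈_ = _≈ℝ_ ; _+_ = _+ℝ_ ; _*_ = _*ℝ_ ; -_ = -ℝ_ ; 0# = 0ℝ ; 1# = 1ℝ
  ; isCommutativeRing = record
    { isRing = record
      { +-isAbelianGroup = record
        { isGroup = record
          { isMonoid = record
            { isSemigroup = record
              { isMagma = record
                { isEquivalence = record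
                  { refl  = pointwise (λ _ → ≡.refl)
                  ; sym   = λ {x} {y} (≈⁺ x≃y) → ≈⁺ (nullℚ-cong
                      (λ i → solve 2 (λ a b → :- (a :- b) := b :- a) ≡.refl (seq x i) (seq y i)) (nullℚ-neg x≃y))
                  ; trans = λ {x} {y} {z} (≈⁺ x≃y) (≈⁺ y≃z) → ≈⁺ (nullℚ-cong
                      (λ i → solve 3 (λ a b c → (a :- b) :+ (b :- c) := a :- c) ≡.refl (seq x i) (seq y i) (seq z i))
                      (nullℚ-+ x≃y y≃z)) }
                ; ∙-cong = λ {x} {x′} {y} {y′} (≈⁺ x≃) (≈⁺ y≃) → ≈⁺ (nullℚ-cong
                    (λ i → solve 4 (λ a b c d → (a :- b) :+ (c :- d) := (a :+ c) :- (b :+ d)) ≡.refl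
                      (seq x i) (seq x′ i) (seq y i) (seq y′ i))
                    (nullℚ-+ x≃ y≃)) }
              ; assoc = λ x y z → pointwise λ i → ℚ.+-assoc (seq x i) (seq y i) (seq z i) }
            ; identity = (λ x → pointwise λ i → ℚ.+-identityˡ (seq x i)) , (λ x → pointwise λ i → ℚ.+-identityʳ (seq x i)) }
          ; inverse = (λ x → pointwise λ i → ℚ.+-inverseˡ (seq x i)) , (λ x → pointwise λ i → ℚ.+-inverseʳ (seq x i))
          ; ⁻¹-cong = λ {x} {y} (≈⁺ x≃y) → ≈⁺ (nullℚ-cong
              (λ i → solve 2 (λ a b → :- (a :- b) := :- a :- :- b) ≡.refl (seq x i) (seq y i)) (nullℚ-neg x≃y)) }
        ; comm = λ x y → pointwise λ i → ℚ.+-comm (seq x i) (seq y i) }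
      ; *-cong = λ {x} {x′} {y} {y′} (≈⁺ x≃) (≈⁺ y≃) → ≈⁺ (nullℚ-cong
          (λ i → solve 4 (λ a b c d → a :* (c :- d) :+ d :* (a :- b) := a :* c :- b :* d) ≡.refl
            (seq x i) (seq x′ i) (seq y i) (seq y′ i))
          (nullℚ-+ (nullℚ-* x y≃) (nullℚ-* y′ x≃)))
      ; *-assoc = λ x y z → pointwise λ i → ℚ.*-assoc (seq x i) (seq y i) (seq z i)
      ; *-identity = (λ x → pointwise λ i → ℚ.*-identityˡ (seq x i)) , (λ x → pointwise λ i → ℚ.*-identityʳ (seq x i))
      ; distrib = (λ x y z → pointwise λ i → ℚ.*-distribˡ-+ (seq x i) (seq y i) (seq z i))
                , (λ x y z → pointwise λ i → ℚ.*-distribʳ-+ (seq x i) (seq y i) (seq z i)) }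
    ; *-comm = λ x y → pointwise λ i → ℚ.*-comm (seq x i) (seq y i) } }

-- Two nested stages: the index from which the approximations of `x k` are small may depend on `k`.
Nullℝ : (ℕ → ℝ) → Set
Nullℝ x = ∀ ε → 0ℚ ℚ.< ε → Eventually λ k → Eventually λ i → ℚ.∣ seq (x k) i ∣ ℚ.< ε

open SemiringMult (CommutativeRing.semiring ℝ-commutativeRing) using () renaming (_×_ to _•_)

seq-• : ∀ k i → seq (k • 1ℝ) i ≡ ℤ.+ k ℚ./ 1
seq-• zero    i = ≡.refl
seq-• (suc k) i = ≡.trans (cong (1ℚ ℚ.+_) (seq-• k i)) (≡.sym (/1-+ (ℤ.+ 1) (ℤ.+ k)))

ℝ-asymptoticRing : AsymptoticRing
ℝ-asymptoticRing = record
  { commutativeRing = ℝ-commutativeRing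
  ; _≤_ = _≲ℝ_
  ; ≤-reflexive = λ {x} {y} (≈⁺ x≃y) → ≲⁺ λ ε ε>0 → eventually
      (λ i h → subst₂ ℚ._<_ (solve 2 (λ a b → b :+ (a :- b) := a) ≡.refl (seq x i) (seq y i)) ≡.refl
        (ℚ.+-monoʳ-< (seq y i) (ℚ.≤-<-trans (p≤∣p∣ _) h)))
      (x≃y ε ε>0)
  ; ≤-trans = λ {x} {y} {z} (≲⁺ x≤y) (≲⁺ y≤z) → ≲⁺ λ ε ε>0 → let δ , δ>0 , eq = halve ε>0 in eventually
      (λ i (h , h′) → ℚ.<-trans h (subst (seq y i ℚ.+ δ ℚ.<_)
        (≡.trans (ℚ.+-assoc (seq z i) δ δ) (cong (seq z i ℚ.+_) eq)) (ℚ.+-monoˡ-< δ h′)))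
      (x≤y δ δ>0 and y≤z δ δ>0)
  ; +-mono-≤ = λ {x} {y} {u} {v} (≲⁺ x≤y) (≲⁺ u≤v) → ≲⁺ λ ε ε>0 → let δ , δ>0 , eq = halve ε>0 in eventually
      (λ i (h , h′) → subst (seq x i ℚ.+ seq u i ℚ.<_)
        (≡.trans (solve 3 (λ a b d → (a :+ d) :+ (b :+ d) := (a :+ b) :+ (d :+ d)) ≡.refl (seq y i) (seq v i) δ)
          (cong (seq y i ℚ.+ seq v i ℚ.+_) eq)) (ℚ.+-mono-< h h′))
      (x≤y δ δ>0 and u≤v δ δ>0)
  ; 0≤1 = ≲⁺ λ ε ε>0 → 0 , λ i _ → ℚ.<-trans (ℚ.positive⁻¹ 1ℚ) (p<p+q 1ℚ ε>0)
  ; *-nonNeg = λ {x} {y} (≲⁺ x≥0) (≲⁺ y≥0) → ≲⁺ λ ε ε>0 → *-nonNegℝ x y x≥0 y≥0 ε ε>0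
  ; Null = Nullℝ
  ; null-cong = λ {x} {y} x≈y null ε ε>0 → let δ , δ>0 , eq = halve ε>0 in eventually
      (λ k h → eventually (λ i (h , h′) → subst (λ t → ℚ.∣ t ∣ ℚ.< ε)
          (solve 2 (λ a b → a :+ :- (a :- b) := b) ≡.refl (seq (x k) i) (seq (y k) i))
          (∣+∣< {seq (x k) i} h (subst (ℚ._< δ) (≡.sym (ℚ.∣-p∣≡∣p∣ _)) h′) eq))
        (h and ≈⁻ (x≈y k) δ δ>0))
      (null δ δ>0)
  ; null-+ = λ {x} {y} null null′ ε ε>0 → let δ , δ>0 , eq = halve ε>0 in eventually
      (λ k (h , h′) → eventually (λ i (h , h′) → ∣+∣< {seq (x k) i} {seq (y k) i} h h′ eq) (h and h′))
      (null δ δ>0 and null′ δ δ>0)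
  ; null-*ˡ = λ {x} a null ε ε>0 → let b , b>0 , a≤b = bounded a ; δ , δ>0 , eq = shrink b>0 ε>0 in eventually
      (λ k h → eventually (λ i (a≤b , h) → ∣*∣< {seq a i} {seq (x k) i} b>0 a≤b h eq) (a≤b and h))
      (null δ δ>0)
  ; null-squeeze = λ {x} {y} x≥0 x≤y null ε ε>0 → let δ , δ>0 , eq = halve ε>0 in eventually
      (λ k h → eventually (λ i ((h , x≤y) , x≥0) → ∣∣<
          (0<p+q⇒-q<p _ x≥0)
          (ℚ.<-trans x≤y (subst (seq (y k) i ℚ.+ δ ℚ.<_) eq (ℚ.+-monoˡ-< δ (ℚ.≤-<-trans (p≤∣p∣ _) h)))))
        ((h and ≲⁻ (x≤y k) δ δ>0) and ≲⁻ (x≥0 k) ε ε>0))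
      (null δ δ>0)
  -- The slack 1 absorbs the tolerance in `≲ℝ`: for large `k`, k x < b + 1 ≤ c + 1 < k ε, and `k`
  -- cancels.
  ; null-decay = λ {x} b x≥0 kx≤b ε ε>0 → let c , c>0 , b≤c = bounded b in eventually
      (λ k c+1<kε → eventually (λ i ((kx<b+1 , b≤c) , x≥0) → ∣∣<
          (0<p+q⇒-q<p _ x≥0)
          (ℚ.*-cancelˡ-<-nonNeg (ℤ.+ k ℚ./ 1) {{ℚ.normalize-nonNeg k 1}} (ℚ.<-trans
            (subst (λ t → t ℚ.* seq (x k) i ℚ.< seq b i ℚ.+ 1ℚ) (seq-• k i) kx<b+1)
            (ℚ.≤-<-trans (ℚ.+-monoˡ-≤ 1ℚ (ℚ.≤-trans (p≤∣p∣ _) b≤c)) c+1<kε))))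
        ((≲⁻ (kx≤b k) 1ℚ (ℚ.positive⁻¹ 1ℚ) and b≤c) and ≲⁻ (x≥0 k) ε ε>0))
      (archimedean (c ℚ.+ 1ℚ) ε ε>0)
  }
  where
    p≤∣p∣ : ∀ p → p ℚ.≤ ℚ.∣ p ∣
    p≤∣p∣ p with ℚ.≤-total 0ℚ p
    ... | inj₁ p≥0 = ℚ.≤-reflexive (≡.sym (ℚ.0≤p⇒∣p∣≡p p≥0))
    ... | inj₂ p≤0 = ℚ.≤-trans p≤0 (ℚ.0≤∣p∣ p)
    0<p+q⇒-q<p : ∀ p {q} → 0ℚ ℚ.< p ℚ.+ q → ℚ.- q ℚ.< p
    0<p+q⇒-q<p p {q} h = subst₂ ℚ._<_ (ℚ.+-identityʳ (ℚ.- q))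
      (solve 2 (λ p q → :- q :+ (p :+ q) := p) ≡.refl p q) (ℚ.+-monoʳ-< (ℚ.- q) h)
    -- The factors are known only to exceed -δ. Expanding (x + δ)(y + δ) > 0 leaves the error (x + y
    -- + δ) δ, at most (b + c + 1) δ for bounds `b` and `c` and δ ≤ 1; hence the choice of δ.
    *-nonNegℝ : ∀ x y → 0ℝ ≤ℝ x → 0ℝ ≤ℝ y → 0ℝ ≤ℝ x *ℝ y
    *-nonNegℝ x y x≥0 y≥0 ε ε>0 =
      let b , b>0 , x≤b = bounded x
          c , c>0 , y≤c = bounded y
          d>0 = ℚ.<-trans (ℚ.<-trans b>0 (p<p+q b c>0)) (p<p+q (b ℚ.+ c) (ℚ.positive⁻¹ 1ℚ))
          δ , δ>0 , δ≤1 , dδ≤ε = shrink≤1 d>0 ε>0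
      in eventually (λ i ((x≤b , y≤c) , (x>-δ , y>-δ)) → ℚ.<-≤-trans (*-pos x>-δ y>-δ)
        (subst (ℚ._≤ seq x i ℚ.* seq y i ℚ.+ ε)
          (solve 3 (λ x y d → x :* y :+ (x :+ y :+ d) :* d := (x :+ d) :* (y :+ d)) ≡.refl (seq x i) (seq y i) δ)
          (ℚ.+-monoʳ-≤ (seq x i ℚ.* seq y i) (ℚ.≤-trans
            (ℚ.*-monoʳ-≤-nonNeg δ {{ℚ.nonNegative (ℚ.<⇒≤ δ>0)}} (ℚ.+-mono-≤ (ℚ.+-mono-≤
              (ℚ.≤-trans (p≤∣p∣ _) x≤b) (ℚ.≤-trans (p≤∣p∣ _) y≤c)) δ≤1))
            dδ≤ε))))
        ((x≤b and y≤c) and (x≥0 δ δ>0 and y≥0 δ δ>0))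

-- Transfer to the waiting time over the reals.

private
  module ℝᵃ = AsymptoticRing ℝ-asymptoticRing

≈ℝ-refl : ∀ {x} → x ≈ℝ x
≈ℝ-refl = pointwise λ _ → ≡.refl

null⇒sumsTo : ∀ x s → Nullℝ (λ k → sumℝ (applyUpTo x (suc k)) -ℝ s) → SumsTo x s
null⇒sumsTo x s null ε ε>0 = let δ , δ>0 , eq = halve ε>0 ; N , h = null δ δ>0 in
  -- `_<ℝ_` requires a fixed rational gap: closeness within ε / 2 leaves the other half as the gap.
  -- The partial sums of `null` start at one term, hence `suc N`.
  suc N , λ { (suc k) (s≤s N≤k) → δ , δ>0 , eventually
    (λ i h → subst (ℚ.∣ seq (sumℝ (applyUpTo x (suc k))) i ℚ.- seq s i ∣ ℚ.+ δ ℚ.≤_) eq (ℚ.+-monoˡ-≤ δ (ℚ.<⇒≤ h)))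
    (h k N≤k) }

fromℤ-isRingHomomorphism : IsRingHomomorphism ℤ.+-*-rawRing (CommutativeRing.rawRing ℝ-commutativeRing) fromℤ
fromℤ-isRingHomomorphism = record
  { isSemiringHomomorphism = record
    { isNearSemiringHomomorphism = record
      { +-isMonoidHomomorphism = record
        { isMagmaHomomorphism = record
          { isRelHomomorphism = record { cong = λ a≡b → pointwise λ _ → cong (ℚ._/ 1) a≡b }
          ; homo = λ a b → pointwise λ _ → /1-+ a b }
        ; ε-homo = pointwise λ _ → ≡.refl }
      ; *-homo = λ a b → pointwise λ _ → /1-* a b }
    ; 1#-homo = pointwise λ _ → ≡.refl }
  ; -‿homo = λ a → pointwise λ _ → /1-neg a }

recip-nonNeg : ∀ x (x>0 : 0ℝ <ℝ x) → 0ℝ ≲ℝ recip x x>0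
recip-nonNeg x (e , e>0 , N , h) = ≲⁺ λ ε ε>0 → N , λ i N≤i →
  ℚ.<-trans (invℚ-pos (ℚ.<-≤-trans e>0 (subst (ℚ._≤ seq x i) (ℚ.+-identityˡ e) (h i N≤i)))) (p<p+q _ ε>0)
  where
    invℚ-pos : ∀ {q} → 0ℚ ℚ.< q → 0ℚ ℚ.< invℚ q
    invℚ-pos {q} q>0 with q ℚ.≟ 0ℚ
    ... | yes q≡0 = ⊥-elim (ℚ.<-irrefl (≡.sym q≡0) q>0)
    ... | no q≢0  = ℚ.positive⁻¹ _ {{ℚ.1/pos⇒pos q {{ℚ.positive q>0}}}}

module RealMoments {m : ℕ} (p : Fin m → ℝ) (p≥0 : ∀ i → 0ℝ ≤ℝ p i) (∑p≃1 : sumℝ (tabulate p) ≃ 1ℝ)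
  (S : Word m) (S≢[] : S ≢ []) (S>0 : All (λ i → 0ℝ <ℝ p i) S) where

  open WaitingMoments ℝ-asymptoticRing p (λ i → ≲⁺ (p≥0 i))
    (subst (_≈ℝ 1ℝ) (cong sumℝ (≡.sym (map-tabulate id p))) (≈⁺ ∑p≃1)) S S≢[]
    (λ {R} R∈ → recip (P p R) (P-pos p (overlap-letters R∈ S>0)))
    -- The membership proof enters `recip` only through the positivity proof, which its sequence
    -- ignores.
    (λ _ _ → pointwise λ _ → ≡.refl)
    (λ {R} R∈ → recip-nonNeg (P p R) (P-pos p (overlap-letters R∈ S>0)))
    (λ {R} R∈ → ≈⁺ (recip-inverse (P p R) (P-pos p (overlap-letters R∈ S>0))))
    fromℤ fromℤ-isRingHomomorphism

  total-sumsTo : SumsTo (λ k → Pr p (equals (waitingTime S) k)) 1ℝ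
  total-sumsTo = null⇒sumsTo (λ k → Pr p (equals (waitingTime S) k)) 1ℝ total-mass

  -- Blocks are typed as Vec Side n, the unfolding of Subset n that appears in the elaborated theorem:
  -- with Subset n the conversion checker would have to unfold real multiplication.
  moment-sumsTo : ∀ n (x : ℕ → ℝ) (y : List (Vec Side n) → ℝ) →
    (∀ k → x k ≈ℝ fromℕ (k ℕ.^ n) *ℝ Pr p (equals (waitingTime S) k)) →
    (∀ π → y π ≈ℝ fromℕ (length π !) *ℝ productℝ (map (λ B → overlapSum p S S>0 ∣ B ∣) π)) →
    SumsTo x (sumℝ (map y (setPartitions n)))
  moment-sumsTo n x y x≈ y≈ = null⇒sumsTo x (sumℝ (map y (setPartitions n))) (moment n x y
    (λ k → ℝᵃ.trans (x≈ k) (pointwise λ _ → ≡.refl)) (λ π → ℝᵃ.trans (y≈ π) (pointwise λ _ → ≡.refl)))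

open import Data.Nat.Base using (_≤_; _^_)

theorem4p8 : (m : ℕ) → 1 ≤ m →
    (p : Fin m → ℝ) → (∀ i → 0ℝ ≤ℝ p i) → sumℝ (tabulate p) ≃ 1ℝ →
    (S : Word m) → S ≢ [] → (S>0 : All (λ i → 0ℝ <ℝ p i) S) →
    (n : ℕ) → 1 ≤ n →
    HasExpectation p (waitingTime S) (_^ n)
    (sumℝ (map (λ π → fromℕ (length π !) *ℝ productℝ (map (λ B → overlapSum p S S>0 ∣ B ∣) π))
    (setPartitions n)))
theorem4p8 m _ p p≥0 ∑p≃1 S S≢[] S>0 n _ = total-sumsTo , moment-sumsTo n
    (λ k → fromℕ (k ^ n) *ℝ Pr p (equals (waitingTime S) k))
    (λ π → fromℕ (length π !) *ℝ productℝ (map (λ B → overlapSum p S S>0 ∣ B ∣) π))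
    (λ _ → ≈ℝ-refl) (λ _ → ≈ℝ-refl)
  where open RealMoments p p≥0 ∑p≃1 S S≢[] S>0
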